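{- For every integer $r\ge 2$ there is $n_0(r)$ such that the following holds. Let $n\ge n_0(r)$ be even and $0 \leq d \leq \frac{n}{28r^2}$, and let $G$ be a graph with $n$ vertices and minimum degree at least $\frac{(r+1)n}{2r} + d$. Then in every $r$-colouring of the edges of $G$ there is a perfect matching with at least $\frac{n}{2r} + d$ edges of the same colour.
   Context: Graphs are finite and simple. An $r$-colouring of the edges is an arbitrary map $E(G)\to[r]$. -}

module Defs where

open import Data.Bool.Base using (Bool; T)
open import Data.Fin.Base using (Fin; _<_)
open import Data.Fin.Properties using (_≟_)
open import Data.Fin.Subset using (∣_∣)
open import Data.Integer.Base using (+_)
open import Data.List.Base using (List; allFin; filter; length; map)
open import Data.List.Extrema.Nat using (min)
open import Data.List.Membership.Propositional using (_∈_)
open import Data.List.Relation.Unary.Unique.Propositional using (Unique)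
open import Data.Nat.Base using (ℕ; NonZero; _*_; _^_)
open import Data.Nat.Properties using (m*n≢0; m^n≢0)
open import Data.Product using (∃!; _×_)
open import Data.Rational.Base using (ℚ; _/_)
open import Data.Sum.Base using (_⊎_)
import Data.Vec.Base as Vec
open import Relation.Binary.PropositionalEquality.Core using (_≡_)
open import Relation.Nullary.Negation.Core using (¬_)

record Graph (n : ℕ) : Set where
  field
    adj     : Fin n → Fin n → Bool
    adj-sym : ∀ u v → adj u v ≡ adj v u
    no-loop : ∀ v → ¬ T (adj v v)

  degree : Fin n → ℕ
  degree v = ∣ Vec.tabulate (adj v) ∣

  -- Every degree is at most n, so the default value n of the minimum only
  -- matters for the empty graph.
  minDegree : ℕ
  minDegree = min n (map degree (allFin n))

open Graph public

-- The unordered pair {u , v} is represented by its increasing enumeration, and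
-- the proofs are irrelevant, so an edge is determined by its set of endpoints.
record Edge {n : ℕ} (G : Graph n) : Set where
  constructor edge
  field
    source target : Fin n
    .ordered      : source < target
    .adjacent     : T (adj G source target)

open Edge public

module _ {n : ℕ} {G : Graph n} where

  Incident : Fin n → Edge G → Set
  Incident v e = v ≡ source e ⊎ v ≡ target e

  -- The edge set is given by a list without repetitions.
  IsPerfectMatching : List (Edge G) → Set
  IsPerfectMatching M =
    Unique M × (∀ v → ∃! _≡_ λ e → e ∈ M × Incident v e)

EdgeColouring : {n : ℕ} → Graph n → ℕ → Set
EdgeColouring G r = Edge G → Fin r

countColour : {n r : ℕ} {G : Graph n} →
              EdgeColouring G r → Fin r → List (Edge G) → ℕ
countColour c i M = length (filter (λ e → c e ≟ i) M)

fromℕ : ℕ → ℚ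
fromℕ m = + m / 1

_/[2*_] : ℕ → (r : ℕ) .{{_ : NonZero r}} → ℚ
m /[2* r ] = (+ m / (2 * r)) {{m*n≢0 2 r}}

_/[28*_^2] : ℕ → (r : ℕ) .{{_ : NonZero r}} → ℚ
m /[28* r ^2] = (+ m / (28 * r ^ 2)) {{m*n≢0 28 (r ^ 2) {{_}} {{m^n≢0 r 2}}}}

{-# OPTIONS --safe #-}

-- Put N = n/2, and choose an integer k ≥ n/2r + d with δ(G) ≥ N + k and
-- 8rk ≤ 8N + k.  A monochromatic matching F with k edges extends to a perfect
-- matching, since every vertex has at least N - k neighbours among the 2(N - k)
-- vertices outside F and Dirac's theorem applies there.
--
-- Suppose that no colour i has such an F, and take a maximum matching of colour
-- i.  Call an endpoint of a matching edge high if it has two unmatched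
-- neighbours of colour i.  Let S_i consist of one high endpoint of each of the
-- s_i edges that have one, and let l_i be the number of the other edges.  Since
-- there is no augmenting path of length 1, 3 or 5, the unmatched vertices
-- together with the partners of S_i are independent in colour i, so that the
-- degrees of colour i outside S_i sum to at most 4 k l_i, where s_i + l_i < k.
-- With s = ∑ s_i and t ≥ 2N - s vertices outside ⋃ S_i, counting all degrees at
-- those vertices gives t (N + k) ≤ t s + 4k (rk - s), which fails for r ≥ 2.

module Submission where

open import Defs
open import Data.Bool.Base using (Bool; true; false; T; if_then_else_)
open import Data.Bool.Properties using (T?)
open import Data.Empty using (⊥; ⊥-elim)
open import Data.Fin.Base as Fin using (Fin)
import Data.Fin.Properties as Fin
open import Data.Fin.Subset using (∣_∣)
import Data.Integer.Base as ℤ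
import Data.Integer.Properties as ℤ
open import Data.List.Base using (List; []; _∷_; _++_; length; map; filter; allFin; tabulate)
import Data.List.Membership.DecPropositional as DecMembership
open import Data.List.Membership.Propositional using (_∈_)
open import Data.List.Membership.Propositional.Properties using (∈-∃++; ∈-++⁺ʳ; ∈-map⁺; ∈-map⁻; ∈-allFin)
open import Data.List.Properties
  using (map-++; length-++; length-map; length-tabulate; ++-assoc; ++-identityʳ; filter-++; filter-all)
open import Data.List.Relation.Binary.Permutation.Propositional
  using (_↭_; ↭-refl; ↭-sym; ↭-trans; ↭-reflexive; ↭⇒↭ₛ; refl; prep; swap; trans)
open import Data.List.Relation.Binary.Permutation.Propositional.Properties
  using (shift; shifts; map⁺; ++⁺; ++⁺ˡ; ++⁺ʳ; All-resp-↭; ∈-resp-↭; ↭-length; ++-commutativeMonoid)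
import Data.List.Relation.Binary.Permutation.Setoid.Properties as Permutationₛ
open import Data.List.Relation.Unary.All as All using (All; []; _∷_)
import Data.List.Relation.Unary.All.Properties as All
open import Data.List.Relation.Unary.AllPairs using ([]; _∷_)
open import Data.List.Relation.Unary.Any using (here; there)
open import Data.List.Relation.Unary.Unique.Propositional using (Unique)
open import Data.List.Relation.Unary.Unique.Propositional.Properties using (allFin⁺)
open import Data.Nat.Base using (ℕ; zero; suc; _+_; _*_; _∸_; _^_; _≤_; _<_; _≥_; z≤n; s≤s; NonZero)
open import Data.Nat.DivMod using (_/_; m/n*n≤m; m≡m%n+[m/n]*n; m%n<n)
open import Data.Nat.Divisibility.Core using (_∣_; divides)
open import Data.Nat.ListAction using (sum)
open import Data.Nat.ListAction.Properties using (sum-++; sum-↭)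
open import Data.Nat.Properties
open import Data.List.Extrema ≤-totalOrder using (min≤xs)
open import Data.Nat.Solver using (module +-*-Solver)
open import Data.Product.Base using (∃; ∃-syntax; _×_; _,_; proj₁; proj₂)
open import Data.Rational.Base as ℚ using (ℚ; 0ℚ)
import Data.Rational.Properties as ℚ
import Data.Rational.Unnormalised.Base as ℚᵘ
import Data.Rational.Unnormalised.Properties as ℚᵘ
open import Data.Sum.Base using (_⊎_; inj₁; inj₂; [_,_]′)
import Data.Vec.Base as Vec
open import Function.Base using (_∘_; id)
open import Relation.Binary.Definitions using (DecidableEquality; tri<; tri≈; tri>)
open import Relation.Binary.PropositionalEquality
  using (_≡_; sym; cong; cong₂; subst; subst₂; module ≡-Reasoning) renaming (refl to ≡-refl; trans to ≡-trans)
open import Relation.Binary.PropositionalEquality.Properties using (setoid)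
open import Relation.Nullary using (yes; no; ¬_; does)
open import Relation.Nullary.Decidable using (isYes; toWitness; fromWitness; dec-true; dec-false)

open import Algebra.Properties.CommutativeSemigroup +-commutativeSemigroup using (interchange)
open +-*-Solver using (solve; con; _:+_; _:*_; _:=_)

private
  variable
    X Y : Set

-- Indicators and sums over finite lists

⟦_⟧ : Bool → ℕ
⟦ b ⟧ = if b then 1 else 0

⟦⟧≤1 : ∀ b → ⟦ b ⟧ ≤ 1
⟦⟧≤1 false = z≤n
⟦⟧≤1 true  = s≤s z≤n

⟦⟧>0⇒T : ∀ b → 0 < ⟦ b ⟧ → T b
⟦⟧>0⇒T true _ = _

T⇒⟦⟧≡1 : ∀ b → T b → ⟦ b ⟧ ≡ 1
T⇒⟦⟧≡1 true _ = ≡-refl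

∑ : List X → (X → ℕ) → ℕ
∑ xs f = sum (map f xs)

∑-++ : ∀ xs ys (f : X → ℕ) → ∑ (xs ++ ys) f ≡ ∑ xs f + ∑ ys f
∑-++ xs ys f = ≡-trans (cong sum (map-++ f xs ys)) (sum-++ (map f xs) (map f ys))

∑-↭ : ∀ {xs ys} (f : X → ℕ) → xs ↭ ys → ∑ xs f ≡ ∑ ys f
∑-↭ f p = sum-↭ (map⁺ f p)

∑-mono : ∀ xs {f g : X → ℕ} → (∀ {x} → x ∈ xs → f x ≤ g x) → ∑ xs f ≤ ∑ xs g
∑-mono []       f≤g = z≤n
∑-mono (x ∷ xs) f≤g = +-mono-≤ (f≤g (here ≡-refl)) (∑-mono xs (λ x∈ → f≤g (there x∈)))

∑-cong : ∀ xs {f g : X → ℕ} → (∀ {x} → x ∈ xs → f x ≡ g x) → ∑ xs f ≡ ∑ xs g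
∑-cong []       f≡g = ≡-refl
∑-cong (x ∷ xs) f≡g = cong₂ _+_ (f≡g (here ≡-refl)) (∑-cong xs (λ x∈ → f≡g (there x∈)))

∑-const : ∀ (xs : List X) c → ∑ xs (λ _ → c) ≡ length xs * c
∑-const []       c = ≡-refl
∑-const (x ∷ xs) c = cong (c +_) (∑-const xs c)

∑-bound : ∀ xs {f : X → ℕ} c → (∀ {x} → x ∈ xs → f x ≤ c) → ∑ xs f ≤ length xs * c
∑-bound xs c f≤c = ≤-trans (∑-mono xs f≤c) (≤-reflexive (∑-const xs c))

∑-bound-below : ∀ xs {f : X → ℕ} c → (∀ {x} → x ∈ xs → c ≤ f x) → length xs * c ≤ ∑ xs f
∑-bound-below xs c c≤f = ≤-trans (≤-reflexive (sym (∑-const xs c))) (∑-mono xs c≤f)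

∑-⟦⟧≤length : ∀ xs (p : X → Bool) → ∑ xs (λ x → ⟦ p x ⟧) ≤ length xs
∑-⟦⟧≤length xs p = ≤-trans (∑-bound xs 1 (λ {x} _ → ⟦⟧≤1 (p x))) (≤-reflexive (*-identityʳ _))

∑-≡0 : ∀ xs {f : X → ℕ} → (∀ {x} → x ∈ xs → f x ≡ 0) → ∑ xs f ≡ 0
∑-≡0 xs f≡0 = ≡-trans (∑-cong xs f≡0) (≡-trans (∑-const xs 0) (*-zeroʳ (length xs)))

∑-+ : ∀ xs (f g : X → ℕ) → ∑ xs (λ x → f x + g x) ≡ ∑ xs f + ∑ xs g
∑-+ []       f g = ≡-refl
∑-+ (x ∷ xs) f g = ≡-trans (cong (f x + g x +_) (∑-+ xs f g)) (interchange (f x) (g x) _ _)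

∑-*ˡ : ∀ xs c (f : X → ℕ) → ∑ xs (λ x → c * f x) ≡ c * ∑ xs f
∑-*ˡ []       c f = sym (*-zeroʳ c)
∑-*ˡ (x ∷ xs) c f = ≡-trans (cong (c * f x +_) (∑-*ˡ xs c f)) (sym (*-distribˡ-+ c (f x) _))

∑-swap : ∀ (xs : List X) (ys : List Y) (f : X → Y → ℕ) →
         ∑ xs (λ x → ∑ ys (f x)) ≡ ∑ ys (λ y → ∑ xs (λ x → f x y))
∑-swap []       ys f = sym (∑-≡0 ys (λ _ → ≡-refl))
∑-swap (x ∷ xs) ys f = ≡-trans (cong (∑ ys (f x) +_) (∑-swap xs ys f))
                               (sym (∑-+ ys (f x) (λ y → ∑ xs (λ x → f x y))))

∑-∈ : ∀ {xs x} (f : X → ℕ) → x ∈ xs → f x ≤ ∑ xs f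
∑-∈ f (here ≡-refl) = m≤m+n _ _
∑-∈ f (there x∈)    = ≤-trans (∑-∈ f x∈) (m≤n+m _ _)

-- `P` will be the existence of a larger matching, so that testing all pairs of vertices for an
-- augmentation ends with such a matching or with a vanishing edge count.
∑≡0-or : ∀ {P : Set} xs {f : X → ℕ} → (∀ {x} → x ∈ xs → P ⊎ f x ≡ 0) → P ⊎ ∑ xs f ≡ 0
∑≡0-or []       h = inj₂ ≡-refl
∑≡0-or (x ∷ xs) h with h (here ≡-refl) | ∑≡0-or xs (λ x∈ → h (there x∈))
... | inj₁ p  | _       = inj₁ p
... | inj₂ _  | inj₁ p  = inj₁ p
... | inj₂ eq | inj₂ es = inj₂ (cong₂ _+_ eq es)

⟦⟧≡0-or : ∀ {P : Set} b → (T b → P) → P ⊎ ⟦ b ⟧ ≡ 0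
⟦⟧≡0-or true  h = inj₁ (h _)
⟦⟧≡0-or false h = inj₂ ≡-refl

extract : ∀ {x : X} {xs} → x ∈ xs → ∃[ ys ] xs ↭ x ∷ ys
extract x∈xs with ∈-∃++ x∈xs
... | ys , zs , ≡-refl = ys ++ zs , shift _ ys zs

pigeonhole-∑ : ∀ xs {f : X → ℕ} c → length xs * c < ∑ xs f → ∃[ x ] x ∈ xs × c < f x
pigeonhole-∑ (x ∷ xs) {f} c lt with c <? f x
... | yes c<fx = x , here ≡-refl , c<fx
... | no  c≮fx with pigeonhole-∑ xs c (+-cancelˡ-< c _ _ (<-≤-trans lt (+-monoˡ-≤ _ (≮⇒≥ c≮fx))))
...   | y , y∈ , c<fy = y , there y∈ , c<fy

-- The element is split off the list instead of merely being a member, so that a later choice from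
-- `ys` uses another entry.
∑⟦⟧>0⇒↭ : ∀ xs (p : X → Bool) → 0 < ∑ xs (λ x → ⟦ p x ⟧) →
          ∃[ x ] ∃[ ys ] T (p x) × xs ↭ x ∷ ys
∑⟦⟧>0⇒↭ xs p pos
  with x , x∈ , px ← pigeonhole-∑ xs 0 (≤-<-trans (≤-reflexive (*-zeroʳ (length xs))) pos)
  with ys , xs↭ ← extract x∈
  = x , ys , ⟦⟧>0⇒T (p x) px , xs↭

-- Matchings as lists of pairs

flat : List (X × X) → List X
flat []            = []
flat ((a , b) ∷ M) = a ∷ b ∷ flat M

flat-++ : ∀ (M N : List (X × X)) → flat (M ++ N) ≡ flat M ++ flat N
flat-++ []            N = ≡-refl
flat-++ ((a , b) ∷ M) N = cong (λ l → a ∷ b ∷ l) (flat-++ M N)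

length-flat : ∀ (M : List (X × X)) → length (flat M) ≡ length M * 2
length-flat []            = ≡-refl
length-flat (_ ∷ M) = cong (λ l → suc (suc l)) (length-flat M)

∑-flat : ∀ (M : List (X × X)) (f : X → ℕ) → ∑ (flat M) f ≡ ∑ M (λ (a , b) → f a + f b)
∑-flat []            f = ≡-refl
∑-flat ((a , b) ∷ M) f = ≡-trans (cong (λ n → f a + (f b + n)) (∑-flat M f)) (sym (+-assoc (f a) _ _))

module ↭-Solver {X : Set} where
  open import Algebra.Solver.CommutativeMonoid (++-commutativeMonoid {A = X}) public

open ↭-Solver using (_⊕_; _⊜_) renaming (solve to ↭-solve)

flat-↭ : ∀ {M N : List (X × X)} → M ↭ N → flat M ↭ flat N
flat-↭ refl = ↭-refl
flat-↭ (prep (a , b) p) = prep a (prep b (flat-↭ p))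
flat-↭ (swap (a , b) (c , d) p) = ↭-trans (shifts (a ∷ b ∷ []) (c ∷ d ∷ [])) (++⁺ˡ (c ∷ d ∷ a ∷ b ∷ []) (flat-↭ p))
flat-↭ (trans p q) = ↭-trans (flat-↭ p) (flat-↭ q)

-- Matchings in graphs

-- Disjointness of the edges is encoded by `cover`: when `V` has no repetitions, the permutation
-- lets no vertex occur twice. Exchanging edges thus becomes rearranging lists.
record PartialMatching {A : Set} (H : A → A → Bool) (V : List A) (m : ℕ) : Set where
  constructor partialMatching
  field
    edges    : List (A × A)
    free     : List A
    adjacent : All (λ (a , b) → T (H a b)) edges
    size     : length edges ≡ m
    cover    : V ↭ flat edges ++ free

-- l is the size of a matching of H[rest] and cutset is the set S of the
-- Tutte–Berge formula, except that the components of H - S are merged into a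
-- single bound on the degree sum.
record Sparse {A : Set} (H : A → A → Bool) (V : List A) (k : ℕ) : Set where
  field
    cutset rest : List A
    l           : ℕ
    cover       : V ↭ cutset ++ rest
    small       : length cutset + l < k
    degreeSum   : ∑ rest (λ v → ∑ rest (λ w → ⟦ H v w ⟧)) ≤ 4 * (k * l)

module _ {A : Set} (H : A → A → Bool) where

  deg : A → List A → ℕ
  deg v xs = ∑ xs (λ w → ⟦ H v w ⟧)

  -- Ordered pairs are counted, so `e xs xs` is the degree sum inside `xs`, with every edge seen
  -- from both ends.
  e : List A → List A → ℕ
  e xs ys = ∑ xs (λ v → deg v ys)

  e-++ˡ : ∀ xs ys zs → e (xs ++ ys) zs ≡ e xs zs + e ys zs
  e-++ˡ xs ys zs = ∑-++ xs ys _

  e≤ : ∀ xs ys → e xs ys ≤ length xs * length ys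
  e≤ xs ys = ∑-bound xs (length ys) (λ {x} _ → ∑-⟦⟧≤length ys (H x))

  module _ (H-sym : ∀ u v → H u v ≡ H v u) (H-irrefl : ∀ v → ¬ T (H v v)) where

    e-comm : ∀ xs ys → e xs ys ≡ e ys xs
    e-comm xs ys = ≡-trans (∑-swap xs ys _)
      (∑-cong ys (λ {y} _ → ∑-cong xs (λ {x} _ → cong ⟦_⟧ (H-sym x y))))

    e-++ʳ : ∀ xs ys zs → e xs (ys ++ zs) ≡ e xs ys + e xs zs
    e-++ʳ xs ys zs = ≡-trans (e-comm xs (ys ++ zs))
      (≡-trans (e-++ˡ ys zs xs) (cong₂ _+_ (e-comm ys xs) (e-comm zs xs)))

    T-sym : ∀ {u v} → T (H u v) → T (H v u)
    T-sym {u} {v} = subst T (H-sym u v)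

    -- The edges of `high` are directed so that the first endpoint is the one with two free
    -- neighbours. This may reverse an edge, so `split` compares lists of vertices and not of edges.
    record Orientation (free : List A) (M : List (A × A)) : Set where
      field
        high low  : List (A × A)
        split     : flat M ↭ flat high ++ flat low
        sizes     : length M ≡ length high + length low
        high-adj  : All (λ (a , b) → T (H a b)) high
        low-adj   : All (λ (a , b) → T (H a b)) low
        high-deg  : All (λ (a , b) → 1 < deg a free) high
        low-deg   : All (λ v → deg v free ≤ 1) (flat low)

    orient : ∀ free M → All (λ (a , b) → T (H a b)) M → Orientation free M
    orient free [] [] = record
      { high = [] ; low = [] ; split = ↭-refl ; sizes = ≡-refl
      ; high-adj = [] ; low-adj = [] ; high-deg = [] ; low-deg = [] }
    orient free ((a , b) ∷ M) (ab ∷ adj)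
      with orient free M adj | 1 <? deg a free | 1 <? deg b free
    ... | o | yes a-high | _ = record
      { Orientation o
      ; high     = (a , b) ∷ high
      ; split    = prep a (prep b split)
      ; sizes    = cong suc sizes
      ; high-adj = ab ∷ high-adj
      ; high-deg = a-high ∷ high-deg }
      where open Orientation o
    ... | o | no _ | yes b-high = record
      { Orientation o
      ; high     = (b , a) ∷ high
      ; split    = swap a b split
      ; sizes    = cong suc sizes
      ; high-adj = T-sym ab ∷ high-adj
      ; high-deg = b-high ∷ high-deg }
      where open Orientation o
    ... | o | no a-low | no b-low = record
      { Orientation o
      ; low      = (a , b) ∷ low
      ; split    = ↭-trans (prep a (prep b split)) (↭-sym (↭-trans (shift a (flat high) _) (prep a (shift b (flat high) _))))
      ; sizes    = ≡-trans (cong suc sizes) (sym (+-suc _ _))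
      ; low-adj  = ab ∷ low-adj
      ; low-deg  = ≮⇒≥ a-low ∷ ≮⇒≥ b-low ∷ low-deg }
      where open Orientation o

    flat-unzip : ∀ (M : List (A × A)) → flat M ↭ map proj₁ M ++ map proj₂ M
    flat-unzip []            = ↭-refl
    flat-unzip ((a , b) ∷ M) = prep a (↭-trans (prep b (flat-unzip M)) (↭-sym (shift b (map proj₁ M) _)))

    -- Removing the single entry `u` costs at most one of the two or more free neighbours. This
    -- keeps the two ends of an augmenting path apart.
    anotherNeighbour : ∀ v u {free free₁} → free ↭ u ∷ free₁ → 1 < deg v free →
                       ∃[ w ] ∃[ free₂ ] T (H v w) × free₁ ↭ w ∷ free₂
    anotherNeighbour v u {free₁ = free₁} p high = ∑⟦⟧>0⇒↭ free₁ (H v)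
      (+-cancelˡ-< 1 _ _ (≤-trans high (≤-trans (≤-reflexive (∑-↭ _ p)) (+-monoˡ-≤ _ (⟦⟧≤1 (H v u))))))

    -- An edge of `H` inside `A₂ ++ U` closes an augmenting path of length 1, 3 or 5. Without such
    -- edges every edge inside `R` meets `B`, whose vertices have at most one free neighbour each;
    -- this makes the degree sum small.
    improve : ∀ {V k m} → m < k → PartialMatching H V m → PartialMatching H V (suc m) ⊎ Sparse H V k
    improve {V} {k} {m} m<k (partialMatching M U M-adj size M-cover) = result
      where
      open Orientation (orient U M M-adj)

      S A₂ B : List A
      S  = map proj₁ high
      A₂ = map proj₂ high
      B  = flat low

      cover′ : V ↭ flat high ++ (B ++ U)
      cover′ = ↭-trans M-cover (↭-trans (++⁺ʳ U split) (↭-reflexive (++-assoc (flat high) B U)))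

      Larger : Set
      Larger = PartialMatching H V (suc m)

      augment₁ : ∀ {u w} → u ∈ U → w ∈ U → T (H u w) → Larger
      augment₁ {u} {w} u∈ w∈ uw with extract u∈
      ... | U₁ , p with ∈-resp-↭ p w∈
      ...   | here ≡-refl = ⊥-elim (H-irrefl u uw)
      ...   | there w∈₁ with U₂ , q ← extract w∈₁ = partialMatching ((u , w) ∷ M) U₂
              (uw ∷ M-adj) (cong suc size)
              (↭-trans M-cover (↭-trans (++⁺ˡ (flat M) (↭-trans p (prep u q)))
                (↭-solve 4 (λ m u w U → m ⊕ (u ⊕ (w ⊕ U)) ⊜ u ⊕ (w ⊕ (m ⊕ U))) ↭-refl
                  (flat M) (u ∷ []) (w ∷ []) U₂)))

      -- The path `u y x w` is augmenting: the high endpoint `x` still has a free neighbour `w` once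
      -- `u` is taken, and `uy`, `xw` replace `xy`.
      augment₂ : ∀ {y u} → y ∈ A₂ → u ∈ U → T (H y u) → Larger
      augment₂ {y} {u} y∈ u∈ yu
        with (x , _) , xy∈ , ≡-refl ← ∈-map⁻ proj₂ y∈
        with h , p ← extract xy∈
        with U₁ , q ← extract u∈
        with w , U₂ , xw , q′ ← anotherNeighbour x u q (All.lookup high-deg xy∈)
        with xy-adj ∷ h-adj ← All-resp-↭ p high-adj
        = partialMatching ((y , u) ∷ (x , w) ∷ h ++ low) U₂
            (yu ∷ xw ∷ All.++⁺ h-adj low-adj)
            (cong suc (≡-trans (cong suc (length-++ h)) (≡-trans (≡-trans (cong (_+ length low) (sym (↭-length p))) (sym sizes)) size)))
            (↭-trans cover′ (↭-trans (++⁺ (flat-↭ p) (++⁺ˡ B (↭-trans q (prep u q′))))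
              (↭-trans (↭-solve 7 (λ x y u w h b U → (x ⊕ (y ⊕ h)) ⊕ (b ⊕ (u ⊕ (w ⊕ U)))
                                       ⊜ y ⊕ (u ⊕ (x ⊕ (w ⊕ ((h ⊕ b) ⊕ U))))) ↭-refl
                     (x ∷ []) (y ∷ []) (u ∷ []) (w ∷ []) (flat h) B U₂)
                (↭-reflexive (cong (λ l → y ∷ u ∷ x ∷ w ∷ l ++ U₂) (sym (flat-++ h low)))))))

      -- The path `u x y z w v` is augmenting: the high endpoints `x` and `w` have free neighbours
      -- `u` and `v`, chosen one after the other, and `ux`, `yz`, `wv` replace `xy` and `wz`.
      augment₃ : ∀ {y z} → y ∈ A₂ → z ∈ A₂ → T (H y z) → Larger
      augment₃ {y} {z} y∈ z∈ yz
        with (x , _) , xy∈ , ≡-refl ← ∈-map⁻ proj₂ y∈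
        with (w , _) , wz∈ , ≡-refl ← ∈-map⁻ proj₂ z∈
        with h₁ , p ← extract xy∈
        with ∈-resp-↭ p wz∈
      -- If both partners come from the same matching edge, they coincide, and `yz` is a loop.
      ... | here ≡-refl = ⊥-elim (H-irrefl y yz)
      ... | there wz∈₁
        with h , p′ ← extract wz∈₁
        with u , U₁ , xu , q ← ∑⟦⟧>0⇒↭ U (H x) (<-trans (s≤s z≤n) (All.lookup high-deg xy∈))
        with v , U₂ , wv , q′ ← anotherNeighbour w u q (All.lookup high-deg wz∈)
        with xy-adj ∷ wz-adj ∷ h-adj ← All-resp-↭ (↭-trans p (prep _ p′)) high-adj
        = partialMatching ((y , z) ∷ (x , u) ∷ (w , v) ∷ h ++ low) U₂
            (yz ∷ xu ∷ wv ∷ All.++⁺ h-adj low-adj)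
            (cong suc (≡-trans (cong (λ l → suc (suc l)) (length-++ h))
              (≡-trans (≡-trans (cong (_+ length low) (sym (↭-length (↭-trans p (prep _ p′))))) (sym sizes)) size)))
            (↭-trans cover′ (↭-trans (++⁺ (flat-↭ (↭-trans p (prep _ p′))) (++⁺ˡ B (↭-trans q (prep u q′))))
              (↭-trans (↭-solve 9 (λ x y w z u v h b U → (x ⊕ (y ⊕ (w ⊕ (z ⊕ h)))) ⊕ (b ⊕ (u ⊕ (v ⊕ U)))
                                       ⊜ y ⊕ (z ⊕ (x ⊕ (u ⊕ (w ⊕ (v ⊕ ((h ⊕ b) ⊕ U))))))) ↭-refl
                     (x ∷ []) (y ∷ []) (w ∷ []) (z ∷ []) (u ∷ []) (v ∷ []) (flat h) B U₂)
                (↭-reflexive (cong (λ l → y ∷ z ∷ x ∷ u ∷ w ∷ v ∷ l ++ U₂) (sym (flat-++ h low)))))))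

      independent : ∀ xs ys → (∀ {x y} → x ∈ xs → y ∈ ys → T (H x y) → Larger) →
                    Larger ⊎ e xs ys ≡ 0
      independent xs ys aug = ∑≡0-or xs λ x∈ → ∑≡0-or ys λ y∈ → ⟦⟧≡0-or _ (aug x∈ y∈)

      R : List A
      R = A₂ ++ (B ++ U)

      module _ (e-UU : e U U ≡ 0) (e-AU : e A₂ U ≡ 0) (e-AA : e A₂ A₂ ≡ 0) where

        a b : ℕ
        a = length high
        b = length low

        e-BA : e B A₂ ≤ (b * 2) * a
        e-BA = ≤-trans (e≤ B A₂) (≤-reflexive (cong₂ _*_ (length-flat low) (length-map proj₂ high)))

        e-BB : e B B ≤ (b * 2) * (b * 2)
        e-BB = ≤-trans (e≤ B B) (≤-reflexive (cong₂ _*_ (length-flat low) (length-flat low)))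

        e-BU : e B U ≤ b * 2
        e-BU = ≤-trans (∑-bound B 1 (All.lookup low-deg))
                 (≤-reflexive (≡-trans (*-identityʳ _) (length-flat low)))

        e-R : ∀ xs → e xs R ≡ e xs A₂ + (e xs B + e xs U)
        e-R xs = ≡-trans (e-++ʳ xs A₂ (B ++ U)) (cong (e xs A₂ +_) (e-++ʳ xs B U))

        e-AR : e A₂ R ≡ e B A₂
        e-AR = ≡-trans (e-R A₂) (≡-trans (cong₂ _+_ e-AA (cong₂ _+_ (e-comm A₂ B) e-AU)) (+-identityʳ _))

        e-UR : e U R ≡ e B U
        e-UR = ≡-trans (e-R U) (≡-trans (cong₂ _+_ (≡-trans (e-comm U A₂) e-AU) (cong₂ _+_ (e-comm U B) e-UU)) (+-identityʳ _))

        -- Only the pairs meeting `B` remain. Both orders together give at most 4ab + 4b² + 4b = 4(a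
        -- + b + 1)b, and a + b + 1 ≤ k because the matching has a + b = m < k edges.
        bound : e R R ≤ 4 * (k * b)
        bound = begin
          e R R
            ≡⟨ ≡-trans (e-++ˡ A₂ (B ++ U) R) (cong (e A₂ R +_) (e-++ˡ B U R)) ⟩
          e A₂ R + (e B R + e U R)
            ≡⟨ cong₂ _+_ e-AR (cong₂ _+_ (e-R B) e-UR) ⟩
          e B A₂ + ((e B A₂ + (e B B + e B U)) + e B U)
            ≤⟨ +-mono-≤ e-BA (+-mono-≤ (+-mono-≤ e-BA (+-mono-≤ e-BB e-BU)) e-BU) ⟩
          b * 2 * a + ((b * 2 * a + (b * 2 * (b * 2) + b * 2)) + b * 2)
            ≡⟨ (solve 2 (λ a b →
                 b :* con 2 :* a :+ ((b :* con 2 :* a :+ (b :* con 2 :* (b :* con 2) :+ b :* con 2)) :+ b :* con 2)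
                 := con 4 :* ((con 1 :+ (a :+ b)) :* b)) ≡-refl a b) ⟩
          4 * (suc (a + b) * b)
            ≤⟨ *-monoʳ-≤ 4 (*-monoˡ-≤ b (subst (λ j → suc j ≤ k) (≡-trans (sym size) sizes) m<k)) ⟩
          4 * (k * b) ∎
          where open ≤-Reasoning

        sparse : Sparse H V k
        sparse = record
          { cutset    = S
          ; rest      = R
          ; l         = b
          ; cover     = ↭-trans cover′ (↭-trans (++⁺ʳ (B ++ U) (flat-unzip high)) (↭-reflexive (++-assoc S A₂ (B ++ U))))
          ; small     = subst (_< k) (≡-trans (≡-trans (sym size) sizes) (cong (_+ b) (sym (length-map proj₁ high)))) m<k
          ; degreeSum = bound }

      result : Larger ⊎ Sparse H V k
      result with independent U U augment₁ | independent A₂ U augment₂ | independent A₂ A₂ augment₃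
      ... | inj₁ larger | _           | _           = inj₁ larger
      ... | inj₂ _      | inj₁ larger | _           = inj₁ larger
      ... | inj₂ _      | inj₂ _      | inj₁ larger = inj₁ larger
      ... | inj₂ e-UU   | inj₂ e-AU   | inj₂ e-AA   = inj₂ (sparse e-UU e-AU e-AA)

    -- The matching grows from the empty one, so no maximum matching has to be chosen: at whatever
    -- size `improve` stops, its certificate is already one for the target `k`.
    matching-or-sparse : ∀ V k → PartialMatching H V k ⊎ Sparse H V k
    matching-or-sparse V k = go k ≤-refl
      where
      go : ∀ m → m ≤ k → PartialMatching H V m ⊎ Sparse H V k
      go zero    _   = inj₁ (partialMatching [] V [] ≡-refl ↭-refl)
      go (suc m) m<k with go m (<⇒≤ m<k)
      ... | inj₁ M = improve m<k M
      ... | inj₂ s = inj₂ s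

-- Dirac's theorem for perfect matchings

-- The four values stand for the adjacencies `ua`, `ub`, `va`, `vb` between two free vertices and a
-- matching edge `ab`. They form two pairs of disjoint edges, and a single missing adjacency spoils
-- only one pair.
three-of-four : ∀ a b c d → 2 < (⟦ a ⟧ + ⟦ b ⟧) + (⟦ c ⟧ + ⟦ d ⟧) → T a × T d ⊎ T b × T c
three-of-four true  b     c     true  _ = inj₁ _
three-of-four true  true  true  false _ = inj₂ _
three-of-four false true  true  d     _ = inj₂ _
three-of-four true  true  false false (s≤s (s≤s ()))
three-of-four true  false true  false (s≤s (s≤s ()))
three-of-four true  false false false (s≤s ())
three-of-four false true  false true  (s≤s (s≤s ()))
three-of-four false true  false false (s≤s ())
three-of-four false false true  true  (s≤s (s≤s ()))
three-of-four false false true  false (s≤s ())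
three-of-four false false false true  (s≤s ())

module _ {A : Set} (H : A → A → Bool)
         (H-sym : ∀ u v → H u v ≡ H v u) (H-irrefl : ∀ v → ¬ T (H v v)) where

  private
    d = deg H

  d-self : ∀ v → ⟦ H v v ⟧ ≡ 0
  d-self v with H v v | H-irrefl v
  ... | true  | ¬t = ⊥-elim (¬t _)
  ... | false | _  = ≡-refl

  -- At least two vertices `u`, `v` are free. If one of them has a free neighbour, that edge is
  -- added. Otherwise all their edges, at least 2p, go to the m < p matching edges, and a matching
  -- edge `ab` receiving three of them is exchanged for two disjoint edges at `u` and `v`.
  dirac-step : ∀ {W p m} → length W ≡ p * 2 → (∀ {v} → v ∈ W → p ≤ d v W) → m < p →
               PartialMatching H W m → PartialMatching H W (suc m)
  dirac-step {W} {p} {m} |W| mindeg m<p (partialMatching M U M-adj size M-cover) = go U ≡-refl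
    where
    lengths : length W ≡ m * 2 + length U
    lengths = ≡-trans (↭-length M-cover) (≡-trans (length-++ (flat M))
      (cong (_+ length U) (≡-trans (length-flat M) (cong (_* 2) size))))

    two-free : 2 ≤ length U
    two-free = +-cancelˡ-≤ (m * 2) 2 (length U) (begin
      m * 2 + 2         ≡⟨ +-comm (m * 2) 2 ⟩
      suc m * 2         ≤⟨ *-monoˡ-≤ 2 m<p ⟩
      p * 2             ≡⟨ ≡-trans (sym |W|) lengths ⟩
      m * 2 + length U  ∎)
      where open ≤-Reasoning

    add : ∀ {x ys w zs} → U ↭ x ∷ ys → ys ↭ w ∷ zs → T (H x w) → PartialMatching H W (suc m)
    add {x} {ys} {w} {zs} p q xw = partialMatching ((x , w) ∷ M) zs (xw ∷ M-adj) (cong suc size)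
      (↭-trans M-cover (↭-trans (++⁺ˡ (flat M) (↭-trans p (prep x q)))
        (↭-solve 4 (λ m x w U → m ⊕ (x ⊕ (w ⊕ U)) ⊜ x ⊕ (w ⊕ (m ⊕ U))) ↭-refl
          (flat M) (x ∷ []) (w ∷ []) zs)))

    exchange : ∀ {u v U′ a b} → U ≡ u ∷ v ∷ U′ → (a , b) ∈ M →
               T (H u a) × T (H v b) ⊎ T (H u b) × T (H v a) → PartialMatching H W (suc m)
    exchange {u} {v} {U′} {a} {b} ≡-refl ab∈ choice
      with M′ , p ← extract ab∈
      with _ ∷ M′-adj ← All-resp-↭ p M-adj
      with choice
    ... | inj₁ (ua , vb) = partialMatching ((u , a) ∷ (v , b) ∷ M′) U′ (ua ∷ vb ∷ M′-adj)
      (cong suc (≡-trans (sym (↭-length p)) size))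
      (↭-trans M-cover (↭-trans (++⁺ʳ _ (flat-↭ p))
        (↭-solve 6 (λ u v a b m U → (a ⊕ (b ⊕ m)) ⊕ (u ⊕ (v ⊕ U)) ⊜ u ⊕ (a ⊕ (v ⊕ (b ⊕ (m ⊕ U))))) ↭-refl
          (u ∷ []) (v ∷ []) (a ∷ []) (b ∷ []) (flat M′) U′)))
    ... | inj₂ (ub , va) = partialMatching ((u , b) ∷ (v , a) ∷ M′) U′ (ub ∷ va ∷ M′-adj)
      (cong suc (≡-trans (sym (↭-length p)) size))
      (↭-trans M-cover (↭-trans (++⁺ʳ _ (flat-↭ p))
        (↭-solve 6 (λ u v a b m U → (a ⊕ (b ⊕ m)) ⊕ (u ⊕ (v ⊕ U)) ⊜ u ⊕ (b ⊕ (v ⊕ (a ⊕ (m ⊕ U))))) ↭-refl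
          (u ∷ []) (v ∷ []) (a ∷ []) (b ∷ []) (flat M′) U′)))

    free∈ : ∀ {x} → x ∈ U → x ∈ W
    free∈ x∈ = ∈-resp-↭ (↭-sym M-cover) (∈-++⁺ʳ (flat M) x∈)

    matched-degree : ∀ {x ys} → U ↭ x ∷ ys → d x ys ≡ 0 → p ≤ ∑ M (λ (a , b) → ⟦ H x a ⟧ + ⟦ H x b ⟧)
    matched-degree {x} {ys} q none = begin
      p                                 ≤⟨ mindeg (free∈ (∈-resp-↭ (↭-sym q) (here ≡-refl))) ⟩
      d x W                             ≡⟨ ≡-trans (∑-↭ _ (↭-trans M-cover (++⁺ˡ (flat M) q))) (∑-++ (flat M) (x ∷ ys) _) ⟩
      d x (flat M) + (⟦ H x x ⟧ + d x ys) ≡⟨ cong₂ (λ i j → d x (flat M) + (i + j)) (d-self x) none ⟩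
      d x (flat M) + 0                  ≡⟨ ≡-trans (+-identityʳ _) (∑-flat M _) ⟩
      ∑ M (λ (a , b) → ⟦ H x a ⟧ + ⟦ H x b ⟧) ∎
      where open ≤-Reasoning

    surplus : ∀ {u v U′} → U ↭ u ∷ v ∷ U′ → d u (v ∷ U′) ≡ 0 → d v (u ∷ U′) ≡ 0 →
              length M * 2 < ∑ M (λ (a , b) → (⟦ H u a ⟧ + ⟦ H u b ⟧) + (⟦ H v a ⟧ + ⟦ H v b ⟧))
    surplus {u} {v} q none-u none-v = begin-strict
      length M * 2 ≡⟨ cong (_* 2) size ⟩
      m * 2        <⟨ *-monoˡ-< 2 m<p ⟩
      p * 2        ≡⟨ ≡-trans (*-comm p 2) (cong (p +_) (+-identityʳ p)) ⟩
      p + p        ≤⟨ +-mono-≤ (matched-degree q none-u) (matched-degree (↭-trans q (swap u v ↭-refl)) none-v) ⟩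
      ∑ M (λ (a , b) → ⟦ H u a ⟧ + ⟦ H u b ⟧) + ∑ M (λ (a , b) → ⟦ H v a ⟧ + ⟦ H v b ⟧)
                   ≡⟨ sym (∑-+ M _ _) ⟩
      ∑ M (λ (a , b) → (⟦ H u a ⟧ + ⟦ H u b ⟧) + (⟦ H v a ⟧ + ⟦ H v b ⟧)) ∎
      where open ≤-Reasoning

    go : ∀ U₀ → U ≡ U₀ → PartialMatching H W (suc m)
    go []       ≡-refl = ⊥-elim (n≮0 two-free)
    go (_ ∷ []) ≡-refl = ⊥-elim (n≮0 (≤-pred two-free))
    go (u ∷ v ∷ U′) ≡-refl with d u (v ∷ U′) in eq₁ | d v (u ∷ U′) in eq₂
    ... | suc _ | _
      with w , zs , uw , q ← ∑⟦⟧>0⇒↭ (v ∷ U′) (H u) (subst (0 <_) (sym eq₁) (s≤s z≤n))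
      = add ↭-refl q uw
    ... | zero | suc _
      with w , zs , vw , q ← ∑⟦⟧>0⇒↭ (u ∷ U′) (H v) (subst (0 <_) (sym eq₂) (s≤s z≤n))
      = add (swap u v ↭-refl) q vw
    ... | zero | zero
      -- The sum over the `m` matching edges is at least 2p > 2m, so one of them contributes more
      -- than 2.
      with (a , b) , ab∈ , three ← pigeonhole-∑ M 2 (surplus ↭-refl eq₁ eq₂)
      = exchange ≡-refl ab∈ (three-of-four (H u a) (H u b) (H v a) (H v b) three)

  dirac : ∀ W p → length W ≡ p * 2 → (∀ {v} → v ∈ W → p ≤ d v W) →
          ∃[ M ] All (λ (a , b) → T (H a b)) M × W ↭ flat M
  dirac W p |W| mindeg = perfect (go p ≤-refl)
    where
    go : ∀ m → m ≤ p → PartialMatching H W m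
    go zero    _   = partialMatching [] W [] ≡-refl ↭-refl
    go (suc m) m<p = dirac-step |W| mindeg m<p (go m (<⇒≤ m<p))

    perfect : PartialMatching H W p → ∃[ M ] All (λ (a , b) → T (H a b)) M × W ↭ flat M
    perfect (partialMatching M U M-adj size M-cover) = M , M-adj ,
      ↭-trans M-cover (↭-reflexive (≡-trans (cong (flat M ++_) (empty U no-free)) (++-identityʳ (flat M))))
      where
      no-free : length U ≡ 0
      no-free = sym (+-cancelˡ-≡ (p * 2) 0 (length U) (begin
        p * 2 + 0                  ≡⟨ +-identityʳ _ ⟩
        p * 2                      ≡⟨ sym |W| ⟩
        length W                   ≡⟨ ≡-trans (↭-length M-cover) (length-++ (flat M)) ⟩
        length (flat M) + length U ≡⟨ cong (_+ length U) (≡-trans (length-flat M) (cong (_* 2) size)) ⟩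
        p * 2 + length U           ∎))
        where open ≡-Reasoning

      empty : ∀ (xs : List A) → length xs ≡ 0 → xs ≡ []
      empty [] _ = ≡-refl

-- Combining the colours

++-disjoint : ∀ {A : Set} (xs : List A) {ys v} → Unique (xs ++ ys) → v ∈ xs → ¬ v ∈ ys
++-disjoint (x ∷ xs) (x∉ ∷ _)  (here ≡-refl) v∈ys = All.lookup x∉ (∈-++⁺ʳ xs v∈ys) ≡-refl
++-disjoint (x ∷ xs) (_ ∷ uniq) (there v∈xs) v∈ys = ++-disjoint xs uniq v∈xs v∈ys

Unique-resp-↭ : ∀ {A : Set} {xs ys : List A} → xs ↭ ys → Unique xs → Unique ys
Unique-resp-↭ {A} p = Permutationₛ.Unique-resp-↭ (setoid A) (↭⇒↭ₛ p)

-- With the larger number written as the smaller one plus x, the two sides differ by x².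
2mn≤m²+n² : ∀ m n → 2 * (m * n) ≤ m * m + n * n
2mn≤m²+n² m n with ≤-total m n
... | inj₁ m≤n with x , eq ← m≤n⇒∃[o]m+o≡n m≤n = subst (λ n → 2 * (m * n) ≤ m * m + n * n) eq
  (≤-trans (m≤m+n _ (x * x)) (≤-reflexive (solve 2 (λ m x →
     con 2 :* (m :* (m :+ x)) :+ x :* x := m :* m :+ (m :+ x) :* (m :+ x)) ≡-refl m x)))
... | inj₂ n≤m with x , eq ← m≤n⇒∃[o]m+o≡n n≤m = subst (λ m → 2 * (m * n) ≤ m * m + n * n) eq
  (≤-trans (m≤m+n _ (x * x)) (≤-reflexive (solve 2 (λ n x →
     con 2 :* ((n :+ x) :* n) :+ x :* x := (n :+ x) :* (n :+ x) :+ n :* n) ≡-refl n x)))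

-- With e = rk - N, p = k - e and z = rk - s, the hypotheses give
-- (z + 2p)(z + p) ≤ 4kz and 7k ≤ 8p.
counting-contradiction : ∀ r k N s L t → 2 ≤ r → 0 < k → N ≤ r * k → 8 * (r * k) ≤ 8 * N + k →
  s + L ≤ r * k → N * 2 ≤ t + s → t * (N + k) ≤ t * s + 4 * (k * L) → ⊥
counting-contradiction r k N s L t 2≤r 0<k N≤rk 8rk≤8N+k s+L≤rk 2N≤t+s edges
  with e , N+e≡rk ← m≤n⇒∃[o]m+o≡n N≤rk
  with z , s+z≡rk ← m≤n⇒∃[o]m+o≡n (≤-trans (m≤m+n s L) s+L≤rk)
  = <-irrefl ≡-refl (<-≤-trans quadratic-< quadratic-≥)
  where
  open ≤-Reasoning

  8e≤k : 8 * e ≤ k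
  8e≤k = +-cancelˡ-≤ (8 * N) _ _ (begin
    8 * N + 8 * e ≡⟨ sym (*-distribˡ-+ 8 N e) ⟩
    8 * (N + e)   ≡⟨ cong (8 *_) N+e≡rk ⟩
    8 * (r * k)   ≤⟨ 8rk≤8N+k ⟩
    8 * N + k     ∎)

  p : ℕ
  p = k ∸ e

  e+p≡k : e + p ≡ k
  e+p≡k = m+[n∸m]≡n (≤-trans (m≤m+n e _) 8e≤k)

  7k≤8p : 7 * k ≤ 8 * p
  7k≤8p = +-cancelˡ-≤ k _ _ (begin
    8 * k         ≡⟨ cong (8 *_) (sym e+p≡k) ⟩
    8 * (e + p)   ≡⟨ *-distribˡ-+ 8 e p ⟩
    8 * e + 8 * p ≤⟨ +-monoˡ-≤ (8 * p) 8e≤k ⟩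
    k + 8 * p     ∎)

  0<p : 0 < p
  0<p = *-cancelˡ-< 8 0 p (<-≤-trans 0<k (≤-trans (m≤m+n k _) 7k≤8p))

  L≤z : L ≤ z
  L≤z = +-cancelˡ-≤ s L z (≤-trans s+L≤rk (≤-reflexive (sym s+z≡rk)))

  z+2p≤t : z + 2 * p ≤ t
  z+2p≤t = +-cancelʳ-≤ (s + 2 * e) _ _ (begin
    z + 2 * p + (s + 2 * e) ≡⟨ solve 4 (λ z p s e → z :+ con 2 :* p :+ (s :+ con 2 :* e)
                                 := (s :+ z) :+ con 2 :* (e :+ p)) ≡-refl z p s e ⟩
    (s + z) + 2 * (e + p)   ≡⟨ cong₂ (λ i j → i + 2 * j) s+z≡rk e+p≡k ⟩
    -- Here r ≥ 2 enters: of the two copies of rk in 2N + 2e, one becomes s + z and the other pays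
    -- for 2k.
    r * k + 2 * k           ≤⟨ +-monoʳ-≤ (r * k) (*-monoˡ-≤ k 2≤r) ⟩
    r * k + r * k           ≡⟨ cong₂ _+_ (sym N+e≡rk) (sym N+e≡rk) ⟩
    (N + e) + (N + e)       ≡⟨ solve 2 (λ N e → (N :+ e) :+ (N :+ e) := N :* con 2 :+ con 2 :* e) ≡-refl N e ⟩
    N * 2 + 2 * e           ≤⟨ +-monoˡ-≤ (2 * e) 2N≤t+s ⟩
    t + s + 2 * e           ≡⟨ +-assoc t s _ ⟩
    t + (s + 2 * e)         ∎)

  N+k≡ : N + k ≡ s + (z + p)
  N+k≡ = begin-equality
    N + k       ≡⟨ cong (N +_) (sym e+p≡k) ⟩
    N + (e + p) ≡⟨ sym (+-assoc N e p) ⟩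
    N + e + p   ≡⟨ cong (_+ p) (≡-trans N+e≡rk (sym s+z≡rk)) ⟩
    s + z + p   ≡⟨ +-assoc s z p ⟩
    s + (z + p) ∎

  t[z+p]≤4kz : t * (z + p) ≤ 4 * (k * z)
  t[z+p]≤4kz = +-cancelˡ-≤ (t * s) _ _ (begin
    t * s + t * (z + p)   ≡⟨ sym (*-distribˡ-+ t s _) ⟩
    t * (s + (z + p))     ≡⟨ cong (t *_) (sym N+k≡) ⟩
    t * (N + k)           ≤⟨ edges ⟩
    t * s + 4 * (k * L)   ≤⟨ +-monoʳ-≤ (t * s) (*-monoʳ-≤ 4 (*-monoʳ-≤ k L≤z)) ⟩
    t * s + 4 * (k * z)   ∎)

  quadratic-≥ : 7 * ((z + 2 * p) * (z + p)) ≤ 32 * (z * p)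
  quadratic-≥ = begin
    -- The factor 7 allows 7k to be replaced by 8p, which leaves an inequality in z and p alone.
    7 * ((z + 2 * p) * (z + p)) ≤⟨ *-monoʳ-≤ 7 (≤-trans (*-monoˡ-≤ (z + p) z+2p≤t) t[z+p]≤4kz) ⟩
    7 * (4 * (k * z))           ≡⟨ solve 2 (λ k z → con 7 :* (con 4 :* (k :* z)) := con 4 :* z :* (con 7 :* k)) ≡-refl k z ⟩
    4 * z * (7 * k)             ≤⟨ *-monoʳ-≤ (4 * z) 7k≤8p ⟩
    4 * z * (8 * p)             ≡⟨ solve 2 (λ p z → con 4 :* z :* (con 8 :* p) := con 32 :* (z :* p)) ≡-refl p z ⟩
    32 * (z * p)                ∎

  quadratic-< : 32 * (z * p) < 7 * ((z + 2 * p) * (z + p))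
  quadratic-< = begin-strict
    32 * (z * p)
      -- The right side is 7z² + 21zp + 14p². Splitting 35 = 21 + 14 leaves 14zp ≤ 7z² + 7p², and
      -- the other 7p² is positive.
      ≤⟨ *-monoˡ-≤ (z * p) (m≤m+n 32 3) ⟩
    35 * (z * p)
      ≡⟨ solve 1 (λ x → con 35 :* x := con 21 :* x :+ con 7 :* (con 2 :* x)) ≡-refl (z * p) ⟩
    21 * (z * p) + 7 * (2 * (z * p))
      ≤⟨ +-monoʳ-≤ (21 * (z * p)) (*-monoʳ-≤ 7 (2mn≤m²+n² z p)) ⟩
    21 * (z * p) + 7 * (z * z + p * p)
      <⟨ m<m+n _ (<-≤-trans (*-mono-< 0<p 0<p) (m≤m+n (p * p) _)) ⟩
    21 * (z * p) + 7 * (z * z + p * p) + 7 * (p * p)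
      ≡⟨ solve 2 (λ z p → con 21 :* (z :* p) :+ con 7 :* (z :* z :+ p :* p) :+ con 7 :* (p :* p)
           := con 7 :* ((z :+ con 2 :* p) :* (z :+ p))) ≡-refl z p ⟩
    7 * ((z + 2 * p) * (z + p)) ∎

-- Degree count outside the cutsets

module _ {A C : Set} (_≟_ : DecidableEquality A) (V : List A) (V-unique : Unique V)
         (colours : List C) (H : C → A → A → Bool) (adj : A → A → Bool)
         (covered : ∀ u v → ⟦ adj u v ⟧ ≤ ∑ colours (λ i → ⟦ H i u v ⟧))
         (k : ℕ) (sparse : ∀ i → Sparse (H i) V k) where

  open DecMembership _≟_ using (_∈?_)

  private
    module Colour (i : C) where
      open Sparse (sparse i) public

      inCutset : A → ℕ
      inCutset v = ⟦ does (v ∈? cutset) ⟧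

      inCutset-cutset : ∀ {v} → v ∈ cutset → inCutset v ≡ 1
      inCutset-cutset {v} v∈ = cong ⟦_⟧ (dec-true (v ∈? cutset) v∈)

      inCutset-rest : ∀ {v} → v ∈ rest → inCutset v ≡ 0
      inCutset-rest {v} v∈ = cong ⟦_⟧ (dec-false (v ∈? cutset)
        (λ v∈S → ++-disjoint cutset (Unique-resp-↭ cover V-unique) v∈S v∈))

      ∑-cover : ∀ f → ∑ V f ≡ ∑ cutset f + ∑ rest f
      ∑-cover f = ≡-trans (∑-↭ f cover) (∑-++ cutset rest f)

      ∑-inCutset : ∑ V inCutset ≤ length cutset
      ∑-inCutset = begin
        ∑ V inCutset                         ≡⟨ ∑-cover inCutset ⟩
        ∑ cutset inCutset + ∑ rest inCutset  ≡⟨ cong (∑ cutset inCutset +_) (∑-≡0 rest inCutset-rest) ⟩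
        ∑ cutset inCutset + 0                ≡⟨ +-identityʳ _ ⟩
        ∑ cutset inCutset                    ≤⟨ ∑-⟦⟧≤length cutset _ ⟩
        length cutset                        ∎
        where open ≤-Reasoning

    open Colour using (inCutset; cutset; rest; l)

    -- Truncated subtraction makes this the indicator function of the
    -- complement of all the cutsets.
    outside : A → ℕ
    outside v = 1 ∸ ∑ colours (λ i → inCutset i v)

    outside≤1 : ∀ v → outside v ≤ 1
    outside≤1 v = m∸n≤m 1 (∑ colours (λ i → inCutset i v))

    s L t : ℕ
    s = ∑ colours (λ i → length (cutset i))
    L = ∑ colours l
    t = ∑ V outside

    outside-cutset : ∀ {i v} → i ∈ colours → v ∈ cutset i → outside v ≡ 0
    outside-cutset {i} {v} i∈ v∈ = m≤n⇒m∸n≡0 (≤-trans (≤-reflexive (sym (Colour.inCutset-cutset i v∈)))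
      (∑-∈ (λ i → inCutset i v) i∈))

    -- This is a union bound: the cutsets of different colours may overlap, and `s` counts a vertex
    -- once for each cutset that contains it.
    V≤t+s : length V ≤ t + s
    V≤t+s = begin
      length V
        ≡⟨ sym (*-identityʳ _) ⟩
      length V * 1
        ≤⟨ ∑-bound-below V 1 (λ {v} _ → ≤-trans (m≤n+m∸n 1 (∑ colours (λ i → inCutset i v))) (≤-reflexive (+-comm _ (outside v)))) ⟩
      ∑ V (λ v → outside v + ∑ colours (λ i → inCutset i v))
        ≡⟨ ∑-+ V outside _ ⟩
      t + ∑ V (λ v → ∑ colours (λ i → inCutset i v))
        ≡⟨ cong (t +_) (∑-swap V colours _) ⟩
      t + ∑ colours (λ i → ∑ V (inCutset i))
        ≤⟨ +-monoʳ-≤ t (∑-mono colours (λ {i} _ → Colour.∑-inCutset i)) ⟩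
      t + s ∎
      where open ≤-Reasoning

    s+L≤ : s + L ≤ length colours * k
    s+L≤ = ≤-trans (≤-reflexive (sym (∑-+ colours _ l)))
      (∑-bound colours k (λ {i} _ → <⇒≤ (Colour.small i)))

    -- A vertex outside all cutsets lies in `rest i`. It has at most |S| neighbours in the cutset S
    -- of colour i, which gives the first term; its degrees into `rest i` are bounded, after
    -- dropping the weight `outside`, by `degreeSum`.
    colour-edges : ∀ {i} → i ∈ colours →
      ∑ V (λ v → outside v * ∑ V (λ w → ⟦ H i v w ⟧)) ≤ t * length (cutset i) + 4 * (k * l i)
    colour-edges {i} i∈ = begin
      ∑ V (λ v → outside v * d v V)
        ≡⟨ ∑-cover _ ⟩
      ∑ S (λ v → outside v * d v V) + ∑ R (λ v → outside v * d v V)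
        ≡⟨ cong (_+ ∑ R (λ v → outside v * d v V)) (∑-≡0 S (λ {v} v∈ → cong (_* d v V) (outside-cutset i∈ v∈))) ⟩
      ∑ R (λ v → outside v * d v V)
        ≤⟨ ∑-mono R (λ {v} _ → rest-degree v) ⟩
      ∑ R (λ v → length S * outside v + d v R)
        ≡⟨ ≡-trans (∑-+ R _ _) (cong (_+ ∑ R (λ v → d v R)) (∑-*ˡ R (length S) outside)) ⟩
      length S * ∑ R outside + ∑ R (λ v → d v R)
        ≤⟨ +-mono-≤ (*-monoʳ-≤ (length S) (≤-trans (m≤n+m _ (∑ S outside)) (≤-reflexive (sym (∑-cover outside))))) (Colour.degreeSum i) ⟩
      length S * t + 4 * (k * l i)
        ≡⟨ cong (_+ 4 * (k * l i)) (*-comm (length S) t) ⟩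
      t * length S + 4 * (k * l i) ∎
      where
      open ≤-Reasoning
      open Colour i using (∑-cover)
      S = cutset i
      R = rest i
      d : A → List A → ℕ
      d v xs = ∑ xs (λ w → ⟦ H i v w ⟧)

      rest-degree : ∀ v → outside v * d v V ≤ length S * outside v + d v R
      rest-degree v = begin
        outside v * d v V                       ≡⟨ cong (outside v *_) (∑-cover _) ⟩
        outside v * (d v S + d v R)             ≡⟨ *-distribˡ-+ (outside v) (d v S) (d v R) ⟩
        outside v * d v S + outside v * d v R   ≤⟨ +-mono-≤ (*-monoʳ-≤ (outside v) (∑-⟦⟧≤length S (H i v))) (*-monoˡ-≤ (d v R) (outside≤1 v)) ⟩
        outside v * length S + 1 * d v R        ≡⟨ cong₂ _+_ (*-comm (outside v) (length S)) (*-identityˡ _) ⟩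
        length S * outside v + d v R            ∎

    -- The degrees at the `t` outside vertices are counted twice: from below by the minimum degree,
    -- and from above colour by colour, since every adjacent pair appears in some colour.
    edges-bound : ∀ D → (∀ {v} → v ∈ V → D ≤ ∑ V (λ w → ⟦ adj v w ⟧)) → t * D ≤ t * s + 4 * (k * L)
    edges-bound D mindeg = begin
      t * D
        ≡⟨ ≡-trans (*-comm t D) (sym (∑-*ˡ V D outside)) ⟩
      ∑ V (λ v → D * outside v)
        ≤⟨ ∑-mono V (λ {v} v∈ → ≤-trans (≤-reflexive (*-comm D _)) (*-monoʳ-≤ (outside v) (≤-trans (mindeg v∈) (split v)))) ⟩
      ∑ V (λ v → outside v * ∑ colours (λ i → ∑ V (λ w → ⟦ H i v w ⟧)))
        ≡⟨ ∑-cong V (λ {v} _ → sym (∑-*ˡ colours (outside v) _)) ⟩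
      ∑ V (λ v → ∑ colours (λ i → outside v * ∑ V (λ w → ⟦ H i v w ⟧)))
        ≡⟨ ∑-swap V colours _ ⟩
      ∑ colours (λ i → ∑ V (λ v → outside v * ∑ V (λ w → ⟦ H i v w ⟧)))
        ≤⟨ ∑-mono colours colour-edges ⟩
      ∑ colours (λ i → t * length (cutset i) + 4 * (k * l i))
        ≡⟨ ∑-+ colours _ _ ⟩
      ∑ colours (λ i → t * length (cutset i)) + ∑ colours (λ i → 4 * (k * l i))
        ≡⟨ cong₂ _+_ (∑-*ˡ colours t _) (≡-trans (∑-*ˡ colours 4 _) (cong (4 *_) (∑-*ˡ colours k l))) ⟩
      t * s + 4 * (k * L) ∎
      where
      open ≤-Reasoning
      split : ∀ v → ∑ V (λ w → ⟦ adj v w ⟧) ≤ ∑ colours (λ i → ∑ V (λ w → ⟦ H i v w ⟧))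
      split v = ≤-trans (∑-mono V (λ {w} _ → covered v w)) (≤-reflexive (∑-swap V colours _))

  not-all-sparse : ∀ N → length V ≡ N * 2 → 2 ≤ length colours → 0 < k →
    N ≤ length colours * k → 8 * (length colours * k) ≤ 8 * N + k →
    ¬ (∀ {v} → v ∈ V → N + k ≤ ∑ V (λ w → ⟦ adj v w ⟧))
  not-all-sparse N |V| 2≤r 0<k N≤rk 8rk≤ mindeg =
    counting-contradiction (length colours) k N s L t 2≤r 0<k N≤rk 8rk≤ s+L≤
      (≤-trans (≤-reflexive (sym |V|)) V≤t+s) (edges-bound (N + k) mindeg)

-- The size of the monochromatic matching

-- `ℚ._/_` reduces to lowest terms, so the comparison passes to unnormalised fractions, whose order
-- is cross multiplication by definition.
/-≤⁺ : ∀ a b c e .{{_ : NonZero b}} .{{_ : NonZero e}} → a * e ≤ c * b → ℤ.+ a ℚ./ b ℚ.≤ ℤ.+ c ℚ./ e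
/-≤⁺ a b@(suc b-1) c e@(suc e-1) ae≤cb = ℚ.toℚᵘ-cancel-≤ (begin
  ℚ.toℚᵘ (ℤ.+ a ℚ./ b)  ≃⟨ ℚ.toℚᵘ-fromℚᵘ (ℚᵘ.mkℚᵘ (ℤ.+ a) b-1) ⟩
  ℚᵘ.mkℚᵘ (ℤ.+ a) b-1   ≤⟨ ℚᵘ.*≤* (subst₂ ℤ._≤_ (ℤ.pos-* a e) (ℤ.pos-* c b) (ℤ.+≤+ ae≤cb)) ⟩
  ℚᵘ.mkℚᵘ (ℤ.+ c) e-1   ≃⟨ ℚ.toℚᵘ-fromℚᵘ (ℚᵘ.mkℚᵘ (ℤ.+ c) e-1) ⟨
  ℚ.toℚᵘ (ℤ.+ c ℚ./ e)  ∎)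
  where open ℚᵘ.≤-Reasoning

/-≤⁻ : ∀ a b c e .{{_ : NonZero b}} .{{_ : NonZero e}} → ℤ.+ a ℚ./ b ℚ.≤ ℤ.+ c ℚ./ e → a * e ≤ c * b
/-≤⁻ a b@(suc b-1) c e@(suc e-1) le
  with ℚᵘ.*≤* h ← ℚᵘ.≤-trans (ℚᵘ.≤-reflexive (ℚᵘ.≃-sym (ℚ.toℚᵘ-fromℚᵘ (ℚᵘ.mkℚᵘ (ℤ.+ a) b-1))))
                    (ℚᵘ.≤-trans (ℚ.toℚᵘ-mono-≤ le) (ℚᵘ.≤-reflexive (ℚ.toℚᵘ-fromℚᵘ (ℚᵘ.mkℚᵘ (ℤ.+ c) e-1))))
  = ℤ.drop‿+≤+ (subst₂ ℤ._≤_ (sym (ℤ.pos-* a e)) (sym (ℤ.pos-* c b)) h)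

/-+ : ∀ a b c e .{{_ : NonZero b}} .{{_ : NonZero e}} .{{_ : NonZero (b * e)}} →
      ℤ.+ a ℚ./ b ℚ.+ ℤ.+ c ℚ./ e ≡ ℤ.+ (a * e + c * b) ℚ./ (b * e)
/-+ a b@(suc b-1) c e@(suc e-1) = ℚ.toℚᵘ-injective (begin-equality
  ℚ.toℚᵘ (ℤ.+ a ℚ./ b ℚ.+ ℤ.+ c ℚ./ e)
    ≃⟨ ℚ.toℚᵘ-homo-+ (ℤ.+ a ℚ./ b) (ℤ.+ c ℚ./ e) ⟩
  ℚ.toℚᵘ (ℤ.+ a ℚ./ b) ℚᵘ.+ ℚ.toℚᵘ (ℤ.+ c ℚ./ e)
    ≃⟨ ℚᵘ.+-cong (ℚ.toℚᵘ-fromℚᵘ (ℚᵘ.mkℚᵘ (ℤ.+ a) b-1)) (ℚ.toℚᵘ-fromℚᵘ (ℚᵘ.mkℚᵘ (ℤ.+ c) e-1)) ⟩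
  (ℤ.+ a ℤ.* ℤ.+ e ℤ.+ ℤ.+ c ℤ.* ℤ.+ b) ℚᵘ./ (b * e)
    ≡⟨ cong (ℚᵘ._/ (b * e)) (≡-trans (cong₂ ℤ._+_ (sym (ℤ.pos-* a e)) (sym (ℤ.pos-* c b))) (sym (ℤ.pos-+ (a * e) (c * b)))) ⟩
  ℤ.+ (a * e + c * b) ℚᵘ./ (b * e)
    ≃⟨ ℚ.toℚᵘ-fromℚᵘ (ℤ.+ (a * e + c * b) ℚᵘ./ (b * e)) ⟨
  ℚ.toℚᵘ (ℤ.+ (a * e + c * b) ℚ./ (b * e)) ∎)
  where open ℚᵘ.≤-Reasoning

fromℕ-+ : ∀ m n → fromℕ m ℚ.+ fromℕ n ≡ fromℕ (m + n)
fromℕ-+ m n = ≡-trans (/-+ m 1 n 1) (cong (λ i → ℤ.+ i ℚ./ 1) (cong₂ _+_ (*-identityʳ m) (*-identityʳ n)))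

-- The real bound 4n/(8r - 1) exceeds n(14r + 1)/(28r²) by n(6r + 1)/(28r²(8r - 1)). For n ≥ 38r²
-- this gap is at least 1 and covers the loss from rounding down.
size-threshold : ∀ r .{{_ : NonZero r}} N → 38 * (r * r) ≤ N * 2 →
  ∃[ K ] (∀ {k} → k ≤ K → 8 * (r * k) ≤ 8 * N + k) × N * 2 * (14 * r + 1) ≤ K * (28 * (r * r))
size-threshold r@(suc q) N n-large = K , ≤K⇒ , K-large
  where
  open ≤-Reasoning
  c n K : ℕ
  c = 8 * q + 7
  n = N * 2
  instance
    c≢0 : NonZero c
    c≢0 = subst NonZero (+-comm 7 (8 * q)) _
  -- Since c = 8r - 1, this is the largest k with 8rk ≤ 8N + k.
  K = (8 * N) / c

  8r≡c+1 : 8 * r ≡ c + 1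
  8r≡c+1 = solve 1 (λ q → con 8 :* (con 1 :+ q) := con 8 :* q :+ con 7 :+ con 1) ≡-refl q

  ≤K⇒ : ∀ {k} → k ≤ K → 8 * (r * k) ≤ 8 * N + k
  ≤K⇒ {k} k≤K = begin
    8 * (r * k)     ≡⟨ sym (*-assoc 8 r k) ⟩
    8 * r * k       ≡⟨ cong (_* k) 8r≡c+1 ⟩
    (c + 1) * k     ≡⟨ *-distribʳ-+ k c 1 ⟩
    c * k + 1 * k   ≡⟨ cong₂ _+_ (*-comm c k) (*-identityˡ k) ⟩
    k * c + k       ≤⟨ +-monoˡ-≤ k (≤-trans (*-monoˡ-≤ c k≤K) (m/n*n≤m (8 * N) c)) ⟩
    8 * N + k       ∎

  8N≤c+Kc : 8 * N ≤ c + K * c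
  8N≤c+Kc = ≤-trans (≤-reflexive (m≡m%n+[m/n]*n (8 * N) c)) (+-monoˡ-≤ (K * c) (<⇒≤ (m%n<n (8 * N) c)))

  K-large : n * (14 * r + 1) ≤ K * (28 * (r * r))
  K-large = *-cancelʳ-≤ _ _ c (+-cancelʳ-≤ (n * (6 * r + 1)) _ _ (begin
    n * (14 * r + 1) * c + n * (6 * r + 1)
      ≡⟨ solve 2 (λ N q → let r = con 1 :+ q in
           N :* con 2 :* (con 14 :* r :+ con 1) :* (con 8 :* q :+ con 7) :+ N :* con 2 :* (con 6 :* r :+ con 1)
           := con 28 :* (r :* r) :* (con 8 :* N)) ≡-refl N q ⟩
    28 * (r * r) * (8 * N)
      ≤⟨ *-monoʳ-≤ (28 * (r * r)) 8N≤c+Kc ⟩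
    28 * (r * r) * (c + K * c)
      ≡⟨ solve 3 (λ r c K → con 28 :* (r :* r) :* (c :+ K :* c)
           := K :* (con 28 :* (r :* r)) :* c :+ r :* r :* (con 28 :* c)) ≡-refl r c K ⟩
    K * (28 * (r * r)) * c + r * r * (28 * c)
      -- The slack 4q + 70 is 38(6r + 1) - 28c; the constant 38 is the least integer above 28 · 8 /
      -- 6.
      ≤⟨ +-monoʳ-≤ (K * (28 * (r * r)) * c) (*-monoʳ-≤ (r * r) (m≤m+n _ (4 * q + 70))) ⟩
    K * (28 * (r * r)) * c + r * r * (28 * c + (4 * q + 70))
      ≡⟨ solve 2 (λ q a → let r = con 1 :+ q in
            a :+ r :* r :* (con 28 :* (con 8 :* q :+ con 7) :+ (con 4 :* q :+ con 70))
            := a :+ con 38 :* (r :* r) :* (con 6 :* r :+ con 1)) ≡-refl q (K * (28 * (r * r)) * c) ⟩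
    K * (28 * (r * r)) * c + 38 * (r * r) * (6 * r + 1)
      ≤⟨ +-monoʳ-≤ (K * (28 * (r * r)) * c) (*-monoˡ-≤ (6 * r + 1) n-large) ⟩
    K * (28 * (r * r)) * c + n * (6 * r + 1) ∎))

module _ (r : ℕ) .{{r≢0 : NonZero r}} (n N δ : ℕ) (n≡ : n ≡ N * 2) (d : ℚ) where

  private
    instance
      2r≢0 : NonZero (2 * r)
      2r≢0 = m*n≢0 2 r
      28r²≢0 : NonZero (28 * r ^ 2)
      28r²≢0 = m*n≢0 28 (r ^ 2) {{_}} {{m^n≢0 r 2}}
      2r28r²≢0 : NonZero (2 * r * (28 * r ^ 2))
      2r28r²≢0 = m*n≢0 (2 * r) (28 * r ^ 2)
      1*2r≢0 : NonZero (1 * (2 * r))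
      1*2r≢0 = m*n≢0 1 (2 * r)

  -- At the largest admissible `d` the target is n/2r + n/28r² = n(14r + 1)/(28r²), the bound
  -- provided by `size-threshold`.
  large-suffices : ∀ {K} → N * 2 * (14 * r + 1) ≤ K * (28 * (r * r)) →
                   d ℚ.≤ n /[28* r ^2] → n /[2* r ] ℚ.+ d ℚ.≤ fromℕ K
  large-suffices {K} K-large d≤ = begin
    n /[2* r ] ℚ.+ d
      ≤⟨ ℚ.+-monoʳ-≤ (n /[2* r ]) d≤ ⟩
    n /[2* r ] ℚ.+ n /[28* r ^2]
      ≡⟨ /-+ n (2 * r) n (28 * r ^ 2) ⟩
    ℤ.+ (n * (28 * r ^ 2) + n * (2 * r)) ℚ./ (2 * r * (28 * r ^ 2))
      ≤⟨ /-≤⁺ (n * (28 * r ^ 2) + n * (2 * r)) (2 * r * (28 * r ^ 2)) K 1 numerators ⟩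
    fromℕ K ∎
    where
    open ℚ.≤-Reasoning
    numerators : (n * (28 * r ^ 2) + n * (2 * r)) * 1 ≤ K * (2 * r * (28 * r ^ 2))
    numerators = subst₂ _≤_
      (solve 2 (λ r n → con 2 :* r :* (n :* (con 14 :* r :+ con 1))
         := (n :* (con 28 :* (r :* (r :* con 1))) :+ n :* (con 2 :* r)) :* con 1) ≡-refl r n)
      (solve 2 (λ r K → con 2 :* r :* (K :* (con 28 :* (r :* r)))
         := K :* (con 2 :* r :* (con 28 :* (r :* (r :* con 1))))) ≡-refl r K)
      (*-monoʳ-≤ (2 * r) (subst (λ n → n * (14 * r + 1) ≤ K * (28 * (r * r))) (sym n≡) K-large))

  -- As `d` is non-negative, k is at least n/2r = N/r.
  suffices⇒N≤rk : ∀ {k} → 0ℚ ℚ.≤ d → n /[2* r ] ℚ.+ d ℚ.≤ fromℕ k → N ≤ r * k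
  suffices⇒N≤rk {k} 0≤d h = *-cancelʳ-≤ N (r * k) 2 (subst₂ _≤_ (≡-trans (*-identityʳ n) n≡)
    (solve 2 (λ k r → k :* (con 2 :* r) := r :* k :* con 2) ≡-refl k r)
    (/-≤⁻ n (2 * r) k 1 (begin
      n /[2* r ]          ≡⟨ sym (ℚ.+-identityʳ (n /[2* r ])) ⟩
      n /[2* r ] ℚ.+ 0ℚ   ≤⟨ ℚ.+-monoʳ-≤ (n /[2* r ]) 0≤d ⟩
      n /[2* r ] ℚ.+ d    ≤⟨ h ⟩
      fromℕ k             ∎)))
    where open ℚ.≤-Reasoning

  module _ (0≤d : 0ℚ ℚ.≤ d) (mindeg : ((r + 1) * n) /[2* r ] ℚ.+ d ℚ.≤ fromℕ δ) where

    private
      -- The degree condition splits as (r + 1)n/2r = n/2 + n/2r with n/2 = N.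
      N+n/2r+d≤δ : fromℕ N ℚ.+ (n /[2* r ] ℚ.+ d) ℚ.≤ fromℕ δ
      N+n/2r+d≤δ = begin
        fromℕ N ℚ.+ (n /[2* r ] ℚ.+ d)
          ≡⟨ sym (ℚ.+-assoc (fromℕ N) (n /[2* r ]) d) ⟩
        fromℕ N ℚ.+ n /[2* r ] ℚ.+ d
          ≡⟨ cong (ℚ._+ d) (/-+ N 1 n (2 * r)) ⟩
        ℤ.+ (N * (2 * r) + n * 1) ℚ./ (1 * (2 * r)) ℚ.+ d
          ≤⟨ ℚ.+-monoˡ-≤ d (/-≤⁺ (N * (2 * r) + n * 1) (1 * (2 * r)) ((r + 1) * n) (2 * r)
               (≤-reflexive (numerators n≡))) ⟩
        ((r + 1) * n) /[2* r ] ℚ.+ d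
          ≤⟨ mindeg ⟩
        fromℕ δ ∎
        where
        open ℚ.≤-Reasoning
        numerators : ∀ {n} → n ≡ N * 2 → (N * (2 * r) + n * 1) * (2 * r) ≡ (r + 1) * n * (1 * (2 * r))
        numerators ≡-refl = solve 2 (λ N r → (N :* (con 2 :* r) :+ N :* con 2 :* con 1) :* (con 2 :* r)
          := (r :+ con 1) :* (N :* con 2) :* (con 1 :* (con 2 :* r))) ≡-refl N r

    N≤δ : N ≤ δ
    N≤δ = subst₂ _≤_ (*-identityʳ N) (*-identityʳ δ) (/-≤⁻ N 1 δ 1 (begin
      fromℕ N                         ≡⟨ sym (ℚ.+-identityʳ (fromℕ N)) ⟩
      fromℕ N ℚ.+ (0ℚ ℚ.+ 0ℚ)         ≤⟨ ℚ.+-monoʳ-≤ (fromℕ N) (ℚ.+-mono-≤ (/-≤⁺ 0 1 n (2 * r) z≤n) 0≤d) ⟩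
      fromℕ N ℚ.+ (n /[2* r ] ℚ.+ d)  ≤⟨ N+n/2r+d≤δ ⟩
      fromℕ δ                         ∎))
      where open ℚ.≤-Reasoning

    δ∸N-suffices : n /[2* r ] ℚ.+ d ℚ.≤ fromℕ (δ ∸ N)
    -- The summand `fromℕ N` is cancelled by contradiction, through strict monotonicity of addition.
    δ∸N-suffices = ℚ.≮⇒≥ λ lt → ℚ.<-irrefl ≡-refl (begin-strict
      fromℕ δ                         ≡⟨ cong fromℕ (sym (m+[n∸m]≡n N≤δ)) ⟩
      fromℕ (N + (δ ∸ N))             ≡⟨ sym (fromℕ-+ N (δ ∸ N)) ⟩
      fromℕ N ℚ.+ fromℕ (δ ∸ N)       <⟨ ℚ.+-monoʳ-< (fromℕ N) lt ⟩
      fromℕ N ℚ.+ (n /[2* r ] ℚ.+ d)  ≤⟨ N+n/2r+d≤δ ⟩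
      fromℕ δ                         ∎)
      where open ℚ.≤-Reasoning

  -- `N+k≤δ` serves both the count over the colours and the extension to a perfect matching. The
  -- last two fields place rk - N between 0 and k/8, as the count requires.
  record Size : Set where
    field
      k        : ℕ
      suffices : n /[2* r ] ℚ.+ d ℚ.≤ fromℕ k
      N+k≤δ    : N + k ≤ δ
      N≤rk     : N ≤ r * k
      8rk≤8N+k : 8 * (r * k) ≤ 8 * N + k

  -- The size is the smaller of δ - N, the limit set by the minimum degree, and K, the limit set by
  -- the count. Both reach n/2r + d, the first by the degree condition and the second by the upper
  -- bound on `d`.
  choose-size : 38 * (r * r) ≤ n → 0ℚ ℚ.≤ d → d ℚ.≤ n /[28* r ^2] →
    ((r + 1) * n) /[2* r ] ℚ.+ d ℚ.≤ fromℕ δ → Size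
  choose-size n-large 0≤d d≤ mindeg = choose (size-threshold r N (subst (38 * (r * r) ≤_) n≡ n-large))
    where
    size : ∀ {k} → n /[2* r ] ℚ.+ d ℚ.≤ fromℕ k → k ≤ δ ∸ N → 8 * (r * k) ≤ 8 * N + k → Size
    size {k} suffices k≤δ∸N 8rk≤8N+k = record
      { k        = k
      ; suffices = suffices
      ; N+k≤δ    = ≤-trans (+-monoʳ-≤ N k≤δ∸N) (≤-reflexive (m+[n∸m]≡n (N≤δ 0≤d mindeg)))
      ; N≤rk     = suffices⇒N≤rk {k} 0≤d suffices
      ; 8rk≤8N+k = 8rk≤8N+k }

    choose : (∃[ K ] (∀ {k} → k ≤ K → 8 * (r * k) ≤ 8 * N + k) × N * 2 * (14 * r + 1) ≤ K * (28 * (r * r))) → Size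
    choose (K , ≤K⇒ , K-large) =
      [ (λ δ∸N≤K → size {δ ∸ N} (δ∸N-suffices 0≤d mindeg) ≤-refl (≤K⇒ δ∸N≤K))
      , (λ K≤δ∸N → size {K} (large-suffices {K} K-large d≤) K≤δ∸N (≤K⇒ ≤-refl)) ]′ (≤-total (δ ∸ N) K)

-- Graphs and edge colourings

-- An arbitrary enumeration `g` is allowed because the induction replaces it by `g ∘ Fin.suc`.
∣tabulate∣ : ∀ {A : Set} n (p : A → Bool) (g : Fin n → A) →
  ∣ Vec.tabulate (p ∘ g) ∣ ≡ ∑ (tabulate g) (λ x → ⟦ p x ⟧)
∣tabulate∣ zero    p g = ≡-refl
∣tabulate∣ (suc n) p g with p (g Fin.zero)
... | true  = cong suc (∣tabulate∣ n p (g ∘ Fin.suc))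
... | false = ∣tabulate∣ n p (g ∘ Fin.suc)

minDegree≤ : ∀ {n} (G : Graph n) v → minDegree G ≤ ∑ (allFin n) (λ w → ⟦ adj G v w ⟧)
minDegree≤ {n} G v = ≤-trans
  (All.lookup (min≤xs n (map (degree G) (allFin n))) (∈-map⁺ (degree G) (∈-allFin v)))
  (≤-reflexive (∣tabulate∣ n (adj G v) id))

factor-positive : ∀ m {n o} → 0 < o → o ≤ m * n → 0 < n
factor-positive m {zero}  0<o o≤ = ≤-trans 0<o (≤-trans o≤ (≤-reflexive (*-zeroʳ m)))
factor-positive m {suc _} _   _  = s≤s z≤n

∃⊎∀ : ∀ {r} {P Q : Fin r → Set} → (∀ i → P i ⊎ Q i) → ∃ P ⊎ (∀ i → Q i)
∃⊎∀ {zero}  h = inj₂ λ ()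
∃⊎∀ {suc r} h with h Fin.zero | ∃⊎∀ (h ∘ Fin.suc)
... | inj₁ p | _            = inj₁ (Fin.zero , p)
... | inj₂ _ | inj₁ (i , p) = inj₁ (Fin.suc i , p)
... | inj₂ q | inj₂ qs      = inj₂ λ { Fin.zero → q ; (Fin.suc i) → qs i }

-- Perfect matchings from lists of endpoints

module _ {n : ℕ} {G : Graph n} where

  endpoints : List (Edge G) → List (Fin n)
  endpoints []       = []
  endpoints (e ∷ es) = source e ∷ target e ∷ endpoints es

  endpoints-++ : ∀ es fs → endpoints (es ++ fs) ≡ endpoints es ++ endpoints fs
  endpoints-++ []       fs = ≡-refl
  endpoints-++ (e ∷ es) fs = cong (λ l → source e ∷ target e ∷ l) (endpoints-++ es fs)

  incident⇒∈ : ∀ {v e es} → e ∈ es → Incident v e → v ∈ endpoints es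
  incident⇒∈ (here ≡-refl) (inj₁ ≡-refl) = here ≡-refl
  incident⇒∈ (here ≡-refl) (inj₂ ≡-refl) = there (here ≡-refl)
  incident⇒∈ (there e∈)    inc           = there (there (incident⇒∈ e∈ inc))

  ∈⇒incident : ∀ {v} es → v ∈ endpoints es → ∃[ e ] e ∈ es × Incident v e
  ∈⇒incident (e ∷ es) (here eq)         = e , here ≡-refl , inj₁ eq
  ∈⇒incident (e ∷ es) (there (here eq)) = e , here ≡-refl , inj₂ eq
  ∈⇒incident (e ∷ es) (there (there v∈)) with f , f∈ , inc ← ∈⇒incident es v∈ = f , there f∈ , inc

  head-disjoint : ∀ {v e es} → Unique (endpoints (e ∷ es)) → Incident v e → ¬ v ∈ endpoints es
  head-disjoint ((_ ∷ s∉) ∷ _ ∷ _) (inj₁ ≡-refl) v∈ = All.lookup s∉ v∈ ≡-refl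
  head-disjoint (_ ∷ t∉ ∷ _)       (inj₂ ≡-refl) v∈ = All.lookup t∉ v∈ ≡-refl

  unique-edges : ∀ es → Unique (endpoints es) → Unique es
  unique-edges []       _ = []
  unique-edges (e ∷ es) u@(_ ∷ _ ∷ us) =
    All.tabulate (λ { f∈ ≡-refl → head-disjoint {e = e} {es} u (inj₁ ≡-refl) (incident⇒∈ f∈ (inj₁ ≡-refl)) })
    ∷ unique-edges es us

  unique-incident : ∀ {v e f} es → Unique (endpoints es) →
    e ∈ es → Incident v e → f ∈ es → Incident v f → e ≡ f
  unique-incident (_ ∷ es) u (here ≡-refl) ve (here ≡-refl) vf = ≡-refl
  unique-incident (e ∷ es) u (here ≡-refl) ve (there f∈)    vf =
    ⊥-elim (head-disjoint {e = e} {es} u ve (incident⇒∈ f∈ vf))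
  unique-incident (f ∷ es) u (there e∈)    ve (here ≡-refl) vf =
    ⊥-elim (head-disjoint {e = f} {es} u vf (incident⇒∈ e∈ ve))
  unique-incident (_ ∷ es) (_ ∷ _ ∷ us) (there e∈) ve (there f∈) vf = unique-incident es us e∈ ve f∈ vf

  -- Every vertex occurs among the endpoints, which gives an incident edge, and occurs only once,
  -- which makes that edge unique.
  endpoints-cover⇒perfect : ∀ es → allFin n ↭ endpoints es → IsPerfectMatching {G = G} es
  endpoints-cover⇒perfect es p = unique-edges es u , λ v →
    let e , e∈ , inc = ∈⇒incident es (∈-resp-↭ p (∈-allFin v)) in
    e , (e∈ , inc) , λ (f∈ , inc′) → unique-incident es u e∈ inc f∈ inc′
    where
    u : Unique (endpoints es)
    u = Unique-resp-↭ p (allFin⁺ n)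

  -- A matching may list a pair in either direction, whereas an `Edge` is increasing; hence the
  -- permutation.
  Realised : (Edge G → Set) → Fin n × Fin n → Set
  Realised P (a , b) = ∃[ e ] P e × a ∷ b ∷ [] ↭ source e ∷ target e ∷ []

  realise : ∀ {P} M → All (Realised P) M →
            ∃[ es ] All P es × length es ≡ length M × flat M ↭ endpoints es
  realise []      []                 = [] , [] , ≡-refl , ↭-refl
  realise (_ ∷ M) ((e , pe , p) ∷ h) with es , pes , len , q ← realise M h =
    e ∷ es , pe ∷ pes , cong suc len , ++⁺ p q

  -- `T true` is the trivial property: the edges added outside the monochromatic part may have any
  -- colour.
  adj-realised : ∀ {a b} → T (adj G a b) → Realised (λ _ → T true) (a , b)
  adj-realised {a} {b} ab with Fin.<-cmp a b
  ... | tri< a<b _ _    = edge a b a<b ab , _ , ↭-refl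
  ... | tri≈ _ ≡-refl _ = ⊥-elim (no-loop G a ab)
  ... | tri> _ _ b<a    = edge b a b<a (subst T (adj-sym G a b) ab) , _ , swap a b ↭-refl

  -- Colour classes and the extension of a monochromatic matching

  module _ {r : ℕ} (c : EdgeColouring G r) where

    -- Only edges have a colour, so adjacency is decided before `c` is applied. The order proof can
    -- be irrelevant because `Edge` ignores it.
    ordered-colour : Fin r → ∀ u v → .(u Fin.< v) → Bool
    ordered-colour i u v u<v with T? (adj G u v)
    ... | yes uv = isYes (c (edge u v u<v uv) Fin.≟ i)
    ... | no _   = false

    coloured : Fin r → Fin n → Fin n → Bool
    coloured i u v with Fin.<-cmp u v
    ... | tri< u<v _ _ = ordered-colour i u v u<v
    ... | tri≈ _ _ _   = false
    ... | tri> _ _ v<u = ordered-colour i v u v<u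

    coloured-sym : ∀ i u v → coloured i u v ≡ coloured i v u
    coloured-sym i u v with Fin.<-cmp u v | Fin.<-cmp v u
    ... | tri< u<v _ _ | tri< v<u _ _ = ⊥-elim (Fin.<-asym u<v v<u)
    ... | tri< _ ≢ _   | tri≈ _ eq _  = ⊥-elim (≢ (sym eq))
    ... | tri< _ _ _   | tri> _ _ _   = ≡-refl
    ... | tri≈ _ eq _  | tri< _ ≢ _   = ⊥-elim (≢ (sym eq))
    ... | tri≈ _ _ _   | tri≈ _ _ _   = ≡-refl
    ... | tri≈ _ eq _  | tri> _ ≢ _   = ⊥-elim (≢ (sym eq))
    ... | tri> _ _ _   | tri< _ _ _   = ≡-refl
    ... | tri> _ ≢ _   | tri≈ _ eq _  = ⊥-elim (≢ (sym eq))
    ... | tri> _ _ v<u | tri> _ _ u<v = ⊥-elim (Fin.<-asym u<v v<u)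

    coloured-irrefl : ∀ i v → ¬ T (coloured i v v)
    coloured-irrefl i v with Fin.<-cmp v v
    ... | tri< v<v _ _ = λ _ → Fin.<-irrefl ≡-refl v<v
    ... | tri≈ _ _ _   = λ ()
    ... | tri> _ _ v<v = λ _ → Fin.<-irrefl ≡-refl v<v

    ordered-realised : ∀ i u v .(u<v : u Fin.< v) → T (ordered-colour i u v u<v) →
                       ∃[ e ] c e ≡ i × (u ≡ source e × v ≡ target e)
    ordered-realised i u v u<v t with T? (adj G u v)
    ... | yes uv = edge u v u<v uv , toWitness t , (≡-refl , ≡-refl)

    coloured-realised : ∀ {i u v} → T (coloured i u v) → Realised (λ e → c e ≡ i) (u , v)
    coloured-realised {i} {u} {v} t with Fin.<-cmp u v
    ... | tri< u<v _ _ with e , ce , (≡-refl , ≡-refl) ← ordered-realised i u v u<v t = e , ce , ↭-refl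
    ... | tri> _ _ v<u with e , ce , (≡-refl , ≡-refl) ← ordered-realised i v u v<u t = e , ce , swap u v ↭-refl

    ordered-covered : ∀ u v .(u<v : u Fin.< v) → T (adj G u v) → ∃[ i ] T (ordered-colour i u v u<v)
    ordered-covered u v u<v uv with T? (adj G u v)
    ... | yes uv′ = c (edge u v u<v uv′) , fromWitness ≡-refl
    ... | no  ¬uv = ⊥-elim (¬uv uv)

    adj⇒coloured : ∀ u v → T (adj G u v) → ∃[ i ] T (coloured i u v)
    adj⇒coloured u v uv with Fin.<-cmp u v
    ... | tri< u<v _ _    = ordered-covered u v u<v uv
    ... | tri≈ _ ≡-refl _ = ⊥-elim (no-loop G u uv)
    ... | tri> _ _ v<u    = ordered-covered v u v<u (subst T (adj-sym G u v) uv)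

    colours-cover : ∀ u v → ⟦ adj G u v ⟧ ≤ ∑ (allFin r) (λ i → ⟦ coloured i u v ⟧)
    colours-cover u v with adj G u v in eq
    ... | false = z≤n
    ... | true with i , t ← adj⇒coloured u v (subst T (sym eq) _) =
      ≤-trans (≤-reflexive (sym (T⇒⟦⟧≡1 _ t))) (∑-∈ (λ i → ⟦ coloured i u v ⟧) (∈-allFin i))

    countColour-++ : ∀ {i} es fs → All (λ e → c e ≡ i) es → length es ≤ countColour c i (es ++ fs)
    countColour-++ {i} es fs all = begin
      length es
        ≤⟨ m≤m+n _ (length (filter P? fs)) ⟩
      length es + length (filter P? fs)
        ≡⟨ cong (λ l → length l + length (filter P? fs)) (sym (filter-all P? all)) ⟩
      length (filter P? es) + length (filter P? fs)
        ≡⟨ sym (length-++ (filter P? es)) ⟩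
      length (filter P? es ++ filter P? fs)
        ≡⟨ cong length (sym (filter-++ P? es fs)) ⟩
      countColour c i (es ++ fs) ∎
      where
      open ≤-Reasoning
      P? = λ e → c e Fin.≟ i

    monochromatic-matching : ∀ N k → n ≡ N * 2 → 2 ≤ r → 0 < k → N ≤ r * k → 8 * (r * k) ≤ 8 * N + k →
      N + k ≤ minDegree G → ∃[ i ] PartialMatching (coloured i) (allFin n) k
    monochromatic-matching N k n≡ 2≤r 0<k N≤rk 8rk≤ mindeg
      with ∃⊎∀ (λ i → matching-or-sparse (coloured i) (coloured-sym i) (coloured-irrefl i) (allFin n) k)
    ... | inj₁ found  = found
    ... | inj₂ sparse = ⊥-elim (not-all-sparse Fin._≟_ (allFin n) (allFin⁺ n) (allFin r) coloured (adj G)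
          colours-cover k sparse N (≡-trans (length-tabulate id) n≡)
          (subst (2 ≤_) (sym r≡) 2≤r) 0<k
          (subst (λ r → N ≤ r * k) (sym r≡) N≤rk)
          (subst (λ r → 8 * (r * k) ≤ 8 * N + k) (sym r≡) 8rk≤)
          (λ {v} _ → ≤-trans mindeg (minDegree≤ G v)))
      where
      r≡ : length (allFin r) ≡ r
      r≡ = length-tabulate id

    extend : ∀ {N k i} → n ≡ N * 2 → N + k ≤ minDegree G → PartialMatching (coloured i) (allFin n) k →
             ∃[ M ] IsPerfectMatching {G = G} M × k ≤ countColour c i M
    extend {N} {k} {i} n≡ mindeg (partialMatching F W F-adj size cover) =
      finish (dirac (adj G) (adj-sym G) (no-loop G) W (N ∸ k) |W| W-degree)
      where
      |flat| : length (flat F) ≡ k * 2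
      |flat| = ≡-trans (length-flat F) (cong (_* 2) size)

      sizes : N * 2 ≡ k * 2 + length W
      sizes = ≡-trans (sym n≡) (≡-trans (sym (length-tabulate id)) (≡-trans (↭-length cover)
        (≡-trans (length-++ (flat F)) (cong (_+ length W) |flat|))))

      -- By `sizes`, 2k ≤ 2N, so no truncation occurs in `N ∸ k`.
      |W| : length W ≡ (N ∸ k) * 2
      |W| = sym (≡-trans (*-distribʳ-∸ 2 N k) (≡-trans (cong (_∸ k * 2) sizes) (m+n∸m≡n (k * 2) (length W))))

      -- At most 2k of the N + k or more neighbours are covered by `F`, so at least N - k remain,
      -- half the size of `W`.
      W-degree : ∀ {v} → v ∈ W → N ∸ k ≤ ∑ W (λ w → ⟦ adj G v w ⟧)
      W-degree {v} _ = m≤n+o⇒m∸n≤o N k (+-cancelʳ-≤ k N _ (begin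
        N + k                                 ≤⟨ ≤-trans mindeg (minDegree≤ G v) ⟩
        ∑ (allFin n) (λ w → ⟦ adj G v w ⟧)    ≡⟨ ≡-trans (∑-↭ _ cover) (∑-++ (flat F) W _) ⟩
        ∑ (flat F) (λ w → ⟦ adj G v w ⟧) + D  ≤⟨ +-monoˡ-≤ D (≤-trans (∑-⟦⟧≤length (flat F) (adj G v)) (≤-reflexive |flat|)) ⟩
        k * 2 + D                             ≡⟨ solve 2 (λ k D → k :* con 2 :+ D := k :+ D :+ k) ≡-refl k D ⟩
        k + D + k                             ∎))
        where
        open ≤-Reasoning
        D = ∑ W (λ w → ⟦ adj G v w ⟧)

      Edges : (Edge G → Set) → List (Fin n × Fin n) → Set
      Edges P M = ∃[ es ] All P es × length es ≡ length M × flat M ↭ endpoints es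

      join : ∀ {M} → W ↭ flat M → Edges (λ e → c e ≡ i) F → Edges (λ _ → T true) M →
             ∃[ M ] IsPerfectMatching {G = G} M × k ≤ countColour c i M
      join W↭M (es , es-col , es-len , F↭es) (fs , _ , _ , M↭fs)
        = es ++ fs
        , endpoints-cover⇒perfect (es ++ fs)
            (↭-trans cover (↭-trans (++⁺ F↭es (↭-trans W↭M M↭fs)) (↭-reflexive (sym (endpoints-++ es fs)))))
        , ≤-trans (≤-reflexive (sym (≡-trans es-len size))) (countColour-++ es fs es-col)

      finish : ∃[ M ] All (λ (a , b) → T (adj G a b)) M × W ↭ flat M →
               ∃[ M ] IsPerfectMatching {G = G} M × k ≤ countColour c i M
      finish (M , M-adj , W↭M) =
        join W↭M (realise F (All.map coloured-realised F-adj)) (realise M (All.map adj-realised M-adj))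

    biased-matching : ∀ N k → n ≡ N * 2 → 2 ≤ r → 0 < k → N ≤ r * k → 8 * (r * k) ≤ 8 * N + k →
      N + k ≤ minDegree G → ∃[ M ] IsPerfectMatching {G = G} M × ∃[ i ] k ≤ countColour c i M
    biased-matching N k n≡ 2≤r 0<k N≤rk 8rk≤ mindeg =
      combine (monochromatic-matching N k n≡ 2≤r 0<k N≤rk 8rk≤ mindeg)
      where
      tag : ∀ {i} → ∃[ M ] IsPerfectMatching {G = G} M × k ≤ countColour c i M →
            ∃[ M ] IsPerfectMatching {G = G} M × ∃[ i ] k ≤ countColour c i M
      tag {i} (M , perfect , k≤) = M , perfect , i , k≤

      combine : ∃[ i ] PartialMatching (coloured i) (allFin n) k →
                ∃[ M ] IsPerfectMatching {G = G} M × ∃[ i ] k ≤ countColour c i M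
      combine (i , F) = tag {i} (extend {N} {k} {i} n≡ mindeg F)

-- Perfect matchings with many edges of one colour

corollary1p12 : ∀ (r : ℕ) .{{_ : NonZero r}} → r ≥ 2 →
    ∃[ n₀ ] ∀ (n : ℕ) → n ≥ n₀ → 2 ∣ n →
    ∀ (d : ℚ) → 0ℚ ℚ.≤ d → d ℚ.≤ n /[28* r ^2] →
    ∀ (G : Graph n) →
    ((r + 1) * n) /[2* r ] ℚ.+ d ℚ.≤ fromℕ (minDegree G) →
    ∀ (c : EdgeColouring G r) →
    ∃[ M ] IsPerfectMatching {G = G} M ×
    (∃[ i ] n /[2* r ] ℚ.+ d ℚ.≤ fromℕ (countColour c i M))
-- From 38r² on, `size-threshold` can absorb the rounding; the bound also makes N, and with it k,
-- positive.
corollary1p12 r 2≤r = 38 * (r * r) , main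
  where
  module _ (n : ℕ) (n-large : n ≥ 38 * (r * r)) (d : ℚ) (G : Graph n) (c : EdgeColouring G r) where

    conclude : ∀ {k} → n /[2* r ] ℚ.+ d ℚ.≤ fromℕ k →
      ∃[ M ] IsPerfectMatching {G = G} M × ∃[ i ] k ≤ countColour c i M →
      ∃[ M ] IsPerfectMatching {G = G} M × (∃[ i ] n /[2* r ] ℚ.+ d ℚ.≤ fromℕ (countColour c i M))
    conclude {k} suffices (M , perfect , i , k≤) =
      M , perfect , i , ℚ.≤-trans suffices (/-≤⁺ k 1 (countColour c i M) 1 (*-monoˡ-≤ 1 k≤))

    matching : ∀ N (n≡ : n ≡ N * 2) → Size r n N (minDegree G) n≡ d →
      ∃[ M ] IsPerfectMatching {G = G} M × (∃[ i ] n /[2* r ] ℚ.+ d ℚ.≤ fromℕ (countColour c i M))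
    matching N n≡ size = conclude {k} suffices
      (biased-matching c N k n≡ 2≤r (factor-positive r 0<N N≤rk) N≤rk 8rk≤8N+k N+k≤δ)
      where
      open Size size
      0<N : 0 < N
      0<N = *-cancelʳ-< 2 0 N (<-≤-trans (*-mono-< {0} {38} (s≤s z≤n) (*-mono-< 0<r 0<r)) (subst (38 * (r * r) ≤_) n≡ n-large))
        where
        0<r : 0 < r
        0<r = ≤-trans (s≤s z≤n) 2≤r

  main : ∀ (n : ℕ) → n ≥ 38 * (r * r) → 2 ∣ n →
    ∀ (d : ℚ) → 0ℚ ℚ.≤ d → d ℚ.≤ n /[28* r ^2] →
    ∀ (G : Graph n) →
    ((r + 1) * n) /[2* r ] ℚ.+ d ℚ.≤ fromℕ (minDegree G) →
    ∀ (c : EdgeColouring G r) →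
    ∃[ M ] IsPerfectMatching {G = G} M ×
    (∃[ i ] n /[2* r ] ℚ.+ d ℚ.≤ fromℕ (countColour c i M))
  main n n-large (divides N n≡) d 0≤d d≤ G mindeg c =
    matching n n-large d G c N n≡ (choose-size r n N (minDegree G) n≡ d n-large 0≤d d≤ mindeg)
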